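{- Let $q$ be a prime power. Let $L$ be an $\mathbb{F}_q$-linear set of rank $n$ in $\Lambda=\mathrm{PG}(r-1,q^t)$ with $\langle L\rangle=\mathrm{PG}(r-1,q^t)$, and suppose that $(L,n)$ does not satisfy condition (A) (as defined in the context). Then in $\mathrm{PG}(n-1,q^t)\supset\Lambda$ there are an $(n-1-r)$-subspace $\Gamma$ disjoint from $\Lambda$ and two $q$-order canonical subgeometries $\Sigma_1,\Sigma_2\subset\mathrm{PG}(n-1,q^t)\setminus\Gamma$ such that $$L=p_{\Gamma,\Lambda}(\Sigma_1)=p_{\Gamma,\Lambda}(\Sigma_2),$$ and such that there exists no collineation $\beta$ of $\mathrm{PG}(n-1,q^t)$ with $\Sigma_1^{\beta}=\Sigma_2$ and $\Gamma^{\beta}=\Gamma$.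
   Context: For a vector space $V$ over a finite field $F$, the points of the associated projective space are the one-dimensional $F$-subspaces of $V$; $\mathrm{PG}_{q^t}(V)$ and $\mathrm{PG}_q(V)$ indicate over which field $V$ is considered, and $\langle v\rangle_{q^t}$ denotes the point spanned by $v\ne0$ over $\mathbb{F}_{q^t}$. For a point set $T$, $\langle T\rangle$ is the projective subspace it spans. All dimensions of projective subspaces are projective dimensions (the empty subspace has dimension $-1$). A collineation is a bijection of points induced by an invertible semilinear map of the underlying vector space. Canonical subgeometry: let $V$ be an $n$-dimensional vector space over $\mathbb{F}_{q^t}$ and let $W\subset V$ be an $\mathbb{F}_q$-subspace with $\dim_{\mathbb{F}_q}W=n$ whose $\mathbb{F}_{q^t}$-span is $V$. Then $\{\langle w\rangle_{q^t}: w\in W\setminus\{0\}\}$ is a ($q$-order) canonical subgeometry of $\mathrm{PG}(n-1,q^t)$; it is isomorphic to $\mathrm{PG}(n-1,q)$. Projection: if $\Sigma'$ is a canonical subgeometry of $\Sigma^*=\mathrm{PG}(n-1,q^t)$, $\Gamma\subset\Sigma^*\setminus\Sigma'$ is an $(n-1-r)$-subspace, and $\Lambda\subset\Sigma^*\setminus\Gamma$ is an $(r-1)$-subspace, then $p_{\Gamma,\Lambda}(\Sigma')=\{\langle\Gamma,P\rangle\cap\Lambda: P\in\Sigma'\}$. Field reduction and linear sets: let $R$ be an $r$-dimensional vector space over $\mathbb{F}_{q^t}$. The field reduction map $\mathcal{F}_{r,t,q}$ sends a point $P=\mathrm{PG}_{q^t}(T)$ of $\mathrm{PG}_{q^t}(R)=\mathrm{PG}(r-1,q^t)$,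 where $T$ is a one-dimensional $\mathbb{F}_{q^t}$-subspace of $R$, to the $(t-1)$-subspace $\mathrm{PG}_q(T)$ of $\mathrm{PG}_q(R)=\mathrm{PG}(rt-1,q)$. With $\mathcal{P}$ the point set of $\mathrm{PG}(r-1,q^t)$, the image $\mathcal{F}_{r,t,q}(\mathcal{P})$ is a partition of the points of $\mathrm{PG}(rt-1,q)$ (a Desarguesian spread). For a subspace $S$ of $\mathrm{PG}(rt-1,q)$, put $\mathcal{B}(S)=\{P\in\mathrm{PG}(r-1,q^t):\mathcal{F}_{r,t,q}(P)\cap S\ne\emptyset\}$. A set $L\subseteq\mathrm{PG}(r-1,q^t)$ is an $\mathbb{F}_q$-linear set of rank $n$ if $L=\mathcal{B}(S)$ for some $(n-1)$-subspace $S$ of $\mathrm{PG}(rt-1,q)$. Condition (A): for a linear set $L$ of rank $n$ in $\mathrm{PG}(r-1,q^t)$, the pair $(L,n)$ satisfies condition (A) if for any two $(n-1)$-subspaces $U,U'\subset\mathrm{PG}(rt-1,q)$ with $\mathcal{B}(U)=L=\mathcal{B}(U')$ there exists a collineation $\gamma\in\mathrm{P\Gamma L}(rt,q)$ such that $U^{\gamma}=U'$, $\gamma$ preserves the Desarguesian spread $\mathcal{F}_{r,t,q}(\mathcal{P})$, and the map induced by $\gamma$ on $\mathrm{PG}(r-1,q^t)$ is a collineation. -}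

module Defs where

open import Level using (Level; 0ℓ; _⊔_) renaming (suc to lsuc)
open import Algebra.Bundles using (CommutativeRing)
open import Algebra.Module.Bundles using (LeftModule)
open import Algebra.Module.Morphism.Structures using (module LeftModuleMorphisms)
open import Algebra.Morphism.Structures using (module RingMorphisms; module GroupMorphisms)
import Algebra.Properties.CommutativeMonoid.Sum as Sum
open import Data.Fin.Base using (Fin)
open import Data.Integer.Base using (ℤ; +_; 1ℤ; _-_)
open import Data.Nat.Base using (ℕ; _^_; _≤_)
open import Data.Nat.Primality using (Prime)
open import Data.Product.Base using (Σ; ∃; ∃-syntax; _×_; _,_; proj₁)
open import Data.Unit.Base using (⊤)
open import Function.Bundles using (Inverse)
open import Function.Definitions using (Bijective)
open import Relation.Binary.Core using (Rel)
open import Relation.Binary.PropositionalEquality as ≡ using (_≡_)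
open import Relation.Nullary.Negation using (¬_)
open import Relation.Unary using (Pred; _∈_; _⊆_; _≐_; _∪_; _∩_)

IsPrimePower : ℕ → Set
IsPrimePower q = ∃[ p ] ∃[ h ] Prime p × 1 ≤ h × q ≡ p ^ h

record Field : Set₁ where
  field
    commutativeRing : CommutativeRing 0ℓ 0ℓ
  open CommutativeRing commutativeRing public
  field
    1≉0     : 1# ≉ 0#
    inverse : ∀ x → x ≉ 0# → ∃[ y ] x * y ≈ 1#

HasOrder : Field → ℕ → Set
HasOrder K N = Inverse (≡.setoid (Fin N)) (Field.setoid K)

record FieldExtension (F K : Field) : Set where
  private
    module F = Field F
    module K = Field K
  field
    embed              : F.Carrier → K.Carrier
    isRingMonomorphism : RingMorphisms.IsRingMonomorphism F.rawRing K.rawRing embed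
  open RingMorphisms.IsRingMonomorphism isRingMonomorphism public

record VectorSpace (K : Field) : Set₁ where
  field
    leftModule : LeftModule (Field.ring K) 0ℓ 0ℓ
  open LeftModule leftModule public

module _ {F K : Field} (φ : FieldExtension F K) where

  private
    module F = Field F
    module K = Field K
    module φ = FieldExtension φ

  restrictScalars : VectorSpace K → VectorSpace F
  restrictScalars V = record { leftModule = record
    { Carrierᴹ     = V.Carrierᴹ
    ; _≈ᴹ_         = V._≈ᴹ_
    ; _+ᴹ_         = V._+ᴹ_
    ; _*ₗ_         = λ a v → φ.embed a V.*ₗ v
    ; 0ᴹ           = V.0ᴹ
    ; -ᴹ_          = V.-ᴹ_
    ; isLeftModule = record
      { isLeftSemimodule = record
        { +ᴹ-isCommutativeMonoid = V.+ᴹ-isCommutativeMonoid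
        ; isPreleftSemimodule    = record
          { *ₗ-cong      = λ a≈b u≈v → V.*ₗ-cong (φ.⟦⟧-cong a≈b) u≈v
          ; *ₗ-zeroˡ     = λ v → V.≈ᴹ-trans (V.*ₗ-cong φ.0#-homo V.≈ᴹ-refl) (V.*ₗ-zeroˡ v)
          ; *ₗ-distribʳ  = λ v a b →
              V.≈ᴹ-trans (V.*ₗ-cong (φ.+-homo a b) V.≈ᴹ-refl) (V.*ₗ-distribʳ v _ _)
          ; *ₗ-identityˡ = λ v →
              V.≈ᴹ-trans (V.*ₗ-cong φ.1#-homo V.≈ᴹ-refl) (V.*ₗ-identityˡ v)
          ; *ₗ-assoc     = λ a b v →
              V.≈ᴹ-trans (V.*ₗ-cong (φ.*-homo a b) V.≈ᴹ-refl) (V.*ₗ-assoc _ _ v)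
          ; *ₗ-zeroʳ     = λ a → V.*ₗ-zeroʳ _
          ; *ₗ-distribˡ  = λ a → V.*ₗ-distribˡ _
          }
        }
      ; -ᴹ‿cong    = V.-ᴹ‿cong
      ; -ᴹ‿inverse = V.-ᴹ‿inverse
      }
    } }
    where module V = VectorSpace V

module _ {K : Field} (V : VectorSpace K) where

  private
    module K = Field K
  open VectorSpace V

  record Subspace (ℓ : Level) : Set (lsuc ℓ) where
    field
      vectors : Pred Carrierᴹ ℓ
      resp    : ∀ {u v} → u ≈ᴹ v → u ∈ vectors → v ∈ vectors
      0∈      : 0ᴹ ∈ vectors
      +∈      : ∀ {u v} → u ∈ vectors → v ∈ vectors → (u +ᴹ v) ∈ vectors
      *∈      : ∀ a {v} → v ∈ vectors → (a *ₗ v) ∈ vectors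

  whole : Subspace 0ℓ
  whole = record { vectors = λ _ → ⊤ }

  lincomb : ∀ {k} → (Fin k → K.Carrier) → (Fin k → Carrierᴹ) → Carrierᴹ
  lincomb c b = Sum.sum +ᴹ-commutativeMonoid (λ i → c i *ₗ b i)

-- Linear span of a set of vectors; `eq` closes it under the setoid equality.
data Span {K : Field} (V : VectorSpace K) {ℓ} (X : Pred (VectorSpace.Carrierᴹ V) ℓ)
          : Pred (VectorSpace.Carrierᴹ V) ℓ where
  gen  : ∀ {v} → v ∈ X → v ∈ Span V X
  zero : VectorSpace.0ᴹ V ∈ Span V X
  add  : ∀ {u v} → u ∈ Span V X → v ∈ Span V X → VectorSpace._+ᴹ_ V u v ∈ Span V X
  mul  : ∀ a {v} → v ∈ Span V X → VectorSpace._*ₗ_ V a v ∈ Span V X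
  eq   : ∀ {u v} → VectorSpace._≈ᴹ_ V u v → u ∈ Span V X → v ∈ Span V X

open Subspace public using (vectors)

span : {K : Field} (V : VectorSpace K) {ℓ : Level} →
       Pred (VectorSpace.Carrierᴹ V) ℓ → Subspace V ℓ
span V X = record { vectors = Span V X ; resp = eq ; 0∈ = zero ; +∈ = add ; *∈ = mul }

module _ {K : Field} {V : VectorSpace K} where

  private
    module K = Field K
  open VectorSpace V

  record HasDim {ℓ} (S : Subspace V ℓ) (k : ℕ) : Set ℓ where
    field
      basis       : Fin k → Carrierᴹ
      basis∈      : ∀ i → basis i ∈ vectors S
      independent : ∀ c → lincomb V c basis ≈ᴹ 0ᴹ → ∀ i → c i K.≈ K.0#
      spanning    : ∀ {v} → v ∈ vectors S → ∃[ c ] v ≈ᴹ lincomb V c basis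

  -- Projective dimension is integer-valued, the empty subspace having dimension -1.
  HasProjDim : ∀ {ℓ} → Subspace V ℓ → ℤ → Set ℓ
  HasProjDim S d = ∃[ k ] HasDim S k × d ≡ + k - 1ℤ

-- Points are one-dimensional vector subspaces, compared by _≃_ below.  A subspace
-- S is identified with the point set `points S` where a set of points is needed.
record Point {K : Field} (V : VectorSpace K) : Set₁ where
  field
    subspace : Subspace V 0ℓ
    oneDim   : HasDim subspace 1

  pvectors : Pred (VectorSpace.Carrierᴹ V) 0ℓ
  pvectors = vectors subspace

open Point public using (pvectors)

PointSet : {K : Field} → VectorSpace K → Set₂
PointSet V = Pred (Point V) (lsuc 0ℓ)

image : {A B : Set} → Rel B 0ℓ → (A → B) → Pred A 0ℓ → Pred B 0ℓ
image _≈_ f X w = ∃[ v ] v ∈ X × f v ≈ w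

module _ {K : Field} {V : VectorSpace K} where

  private
    module K = Field K
  open VectorSpace V

  infix 4 _≃_
  _≃_ : Rel (Point V) 0ℓ
  P ≃ Q = pvectors P ≐ pvectors Q

  points : ∀ {ℓ} → Subspace V ℓ → Pred (Point V) ℓ
  points S P = pvectors P ⊆ vectors S

  ⟨_⟩ : PointSet V → Subspace V (lsuc 0ℓ)
  ⟨ T ⟩ = span V (λ v → ∃[ P ] P ∈ T × v ∈ pvectors P)

  infixl 8 _∨_
  _∨_ : Subspace V 0ℓ → Point V → Subspace V 0ℓ
  Γ ∨ P = span V (vectors Γ ∪ pvectors P)

  -- The image T^β of a point set, closed under equality of points.
  infixl 8 _^^_
  _^^_ : ∀ {ℓ} → Pred (Point V) ℓ → (Point V → Point V) → Pred (Point V) (lsuc 0ℓ ⊔ ℓ)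
  (T ^^ β) Q = ∃[ P ] P ∈ T × β P ≃ Q

module _ {K : Field} (V : VectorSpace K) where

  private
    module K = Field K
  open VectorSpace V

  record SemilinearAutomorphism : Set where
    field
      σ                  : K.Carrier → K.Carrier
      σ-isAutomorphism   : RingMorphisms.IsRingIsomorphism K.rawRing K.rawRing σ
      f                  : Carrierᴹ → Carrierᴹ
      isGroupIsomorphism : GroupMorphisms.IsGroupIsomorphism +ᴹ-rawGroup +ᴹ-rawGroup f
      semilinear         : ∀ a v → f (a *ₗ v) ≈ᴹ σ a *ₗ f v

  record IsCollineation (β : Point V → Point V) : Set₁ where
    field
      bijective    : Bijective _≃_ _≃_ β
      semilinear   : SemilinearAutomorphism
      isInduced    : ∀ P → pvectors (β P)
                             ≐ image _≈ᴹ_ (SemilinearAutomorphism.f semilinear) (pvectors P)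

-- A realisation of PG(R) as a subspace, `range`, of PG(V).
record Embedding {K : Field} (R V : VectorSpace K) : Set where
  private
    module R = VectorSpace R
    module V = VectorSpace V
  open LeftModuleMorphisms R.rawLeftModule V.rawLeftModule
  field
    embed          : R.Carrierᴹ → V.Carrierᴹ
    isMonomorphism : IsLeftModuleMonomorphism embed
  open IsLeftModuleMonomorphism isMonomorphism public

  range : Subspace V 0ℓ
  range = record
    { vectors = image V._≈ᴹ_ embed (λ _ → ⊤)
    ; resp    = λ { u≈v (x , _ , e) → x , _ , V.≈ᴹ-trans e u≈v }
    ; 0∈      = R.0ᴹ , _ , 0ᴹ-homo
    ; +∈      = λ { (x , _ , e) (y , _ , e′) →
                    x R.+ᴹ y , _ , V.≈ᴹ-trans (+ᴹ-homo x y) (V.+ᴹ-cong e e′) }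
    ; *∈      = λ { a (x , _ , e) →
                    a R.*ₗ x , _ ,
                    V.≈ᴹ-trans (*ₗ-homo a x) (V.*ₗ-cong (Field.refl K) e) }
    }

  imagePoints : PointSet R → PointSet V
  imagePoints T Q = ∃[ P ] P ∈ T × pvectors Q ≐ image V._≈ᴹ_ embed (pvectors P)

-- p_{Γ,Λ}(T) = { ⟨Γ,P⟩ ∩ Λ : P ∈ T }, meaningful when Γ is disjoint from Λ and
-- from T, and when Γ and Λ together span.
projection : {K : Field} {V : VectorSpace K} → Subspace V 0ℓ → Subspace V 0ℓ →
             PointSet V → PointSet V
projection Γ Λ T Q = ∃[ P ] P ∈ T × pvectors Q ≐ vectors (Γ ∨ P) ∩ vectors Λ

Disjoint : {K : Field} {V : VectorSpace K} {ℓ₁ ℓ₂ : Level} →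
           Pred (Point V) ℓ₁ → Pred (Point V) ℓ₂ → Set (lsuc 0ℓ ⊔ ℓ₁ ⊔ ℓ₂)
Disjoint S T = ∀ P → P ∈ S → ¬ P ∈ T

module _ {F K : Field} (φ : FieldExtension F K) where

  IsCanonicalSubgeometry : (V : VectorSpace K) → PointSet V → Set₁
  IsCanonicalSubgeometry V T =
    ∃[ n ] HasDim (whole V) n ×
    Σ (Subspace (restrictScalars φ V) 0ℓ) λ W →
      HasDim W n ×
      Span V (vectors W) ≐ vectors (whole V) ×
      T ≐ λ P → ∃[ w ] w ∈ vectors W × w ≉ᴹ 0ᴹ × pvectors P ≐ Span V (_≈ᴹ w)
    where open VectorSpace V

  module _ (R : VectorSpace K) where

    private
      Rq : VectorSpace F
      Rq = restrictScalars φ R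

    fieldReduction : Point R → Subspace Rq 0ℓ
    fieldReduction P = record
      { vectors = pvectors P
      ; resp    = S.resp
      ; 0∈      = S.0∈
      ; +∈      = S.+∈
      ; *∈      = λ a → S.*∈ _
      }
      where module S = Subspace (Point.subspace P)

    -- The point Q witnesses that the projective subspaces F(P) and S intersect.
    𝓑 : Subspace Rq 0ℓ → PointSet R
    𝓑 S P = ∃[ Q ] Q ∈ points (fieldReduction P) ∩ points S

    IsLinearSet : PointSet R → ℕ → Set₁
    IsLinearSet L n = ∃[ S ] HasProjDim S (+ n - 1ℤ) × L ≐ 𝓑 S

    -- γ permutes the elements of the Desarguesian spread; since F is injective on
    -- points, `into` determines the induced map up to equality of points.
    record PreservesSpread (γ : Point Rq → Point Rq) : Set₁ where
      field
        into : ∀ P → ∃[ P′ ] points (fieldReduction P) ^^ γ ≐ points (fieldReduction P′)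
        onto : ∀ P′ → ∃[ P ] points (fieldReduction P) ^^ γ ≐ points (fieldReduction P′)

      inducedMap : Point R → Point R
      inducedMap P = proj₁ (into P)

    ConditionA : PointSet R → ℕ → Set₁
    ConditionA L n =
      (U U′ : Subspace Rq 0ℓ) →
      HasProjDim U (+ n - 1ℤ) → HasProjDim U′ (+ n - 1ℤ) →
      𝓑 U ≐ L → L ≐ 𝓑 U′ →
      ∃[ γ ] IsCollineation Rq γ ×
             points U ^^ γ ≐ points U′ ×
             Σ (PreservesSpread γ) λ pr →
               IsCollineation R (PreservesSpread.inducedMap pr)

{-# OPTIONS --safe #-}
module Submission where

-- Over finite fields everything in sight can be enumerated, so the failure of condition (A) yields two
-- explicit F_q-subspaces U₁, U₂ of rank n, both representing L, such that no semilinear automorphism of R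
-- carries U₁ to U₂.  Fix a complement Γ of Λ in V and let p : V → R be the projection from Γ.  Since L spans, a
-- basis of each Uᵢ spans R and lifts along p to a basis of V; its F_q-span Wᵢ gives Σᵢ, and p maps Wᵢ
-- onto Uᵢ.  A collineation fixing Γ and taking Σ₁ to Σ₂ is induced by a semilinear f, which, rescaled so
-- as to map W₁ onto W₂, descends along p to a semilinear automorphism of R carrying U₁ to U₂.

open import Defs hiding (zero; add; mul; eq)
open import Level using (0ℓ; Lift; lift; lower) renaming (suc to lsuc)
open import Algebra.Morphism.Structures using (module RingMorphisms; module GroupMorphisms)
import Algebra.Properties.CommutativeMonoid.Sum as Sum
import Algebra.Properties.Group as GroupProperties
import Algebra.Properties.Ring as RingProperties
open import Data.Fin.Base using (Fin; zero; suc; punchOut; finToFun; funToFin; combine; splitAt; _↑ˡ_; _↑ʳ_)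
import Data.Fin.Properties as Fin
open import Data.Integer.Base using (+_; 1ℤ; _-_)
import Data.Integer.Base as ℤ
import Data.Integer.Properties as ℤ
open import Data.Integer.Tactic.RingSolver using (solve-∀)
open import Data.Nat.Base using (ℕ; _^_; _≤_)
import Data.Nat.Base as ℕ
import Data.Nat.Properties as ℕ
open import Data.Product.Base using (Σ; ∃; ∃-syntax; ∃₂; _×_; _,_; proj₁; proj₂)
open import Data.Sum.Base using (inj₁; inj₂; [_,_]′)
open import Data.Unit.Base using (tt)
open import Data.Vec.Functional using (_∷_; _++_)
open import Data.Vec.Functional.Relation.Binary.Equality.Setoid using (≋-setoid)
open import Function.Base using (_∘_; id)
open import Function.Bundles using (Inverse)
open import Relation.Binary.Bundles using (Setoid)
open import Relation.Binary.Definitions using (Decidable; _Respects_)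
open import Relation.Binary.PropositionalEquality as ≡ using (_≡_)
import Relation.Binary.Reasoning.Setoid as SetoidReasoning
open import Relation.Nullary.Decidable using (Dec; yes; no; map′; ¬?; _×-dec_; _→-dec_; decidable-stable)
open import Relation.Nullary.Negation using (¬_; contradiction)
open import Relation.Unary using (Pred; _∈_; _⊆_; _≐_; _∩_)

-- Finite setoids

-- Constructively, the negation of condition (A) only refutes a universal statement about arbitrary
-- predicates `U`, `U′` and arbitrary maps on points, none of which can be searched directly. It
-- becomes a finite search once subspaces are replaced by n-tuples of vectors, semilinear
-- automorphisms by pairs of value tables, and `𝓑 U ⊆ 𝓑 U′` by a condition on vectors. Condition (A)
-- asks for a collineation over F_q as well as over F_q^t, so the companion automorphism σ has to
-- map the embedded copy of F into itself. This must be extracted from Σ₁^β = Σ₂, which only says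
-- that f sends each vector of W₁ to a K-multiple of a vector of W₂, with a factor that may vary
-- with the vector. Two basis vectors are what it takes to control σ on F; ranks 0 and 1 therefore
-- get an argument of their own, by scalings.

Finite : ℕ → Setoid 0ℓ 0ℓ → Set
Finite N S = Inverse (≡.setoid (Fin N)) S

funToFin-cong : ∀ {k N} {f g : Fin k → Fin N} → (∀ i → f i ≡ g i) → funToFin f ≡ funToFin g
funToFin-cong {ℕ.zero}  f≗g = ≡.refl
funToFin-cong {ℕ.suc k} f≗g = ≡.cong₂ combine (f≗g zero) (funToFin-cong (f≗g ∘ suc))

-- A missed value y could be punched out of the codomain, leaving an injection of a set of size N +
-- 1 into one of size N.
Fin-injective⇒surjective : ∀ {N} (f : Fin N → Fin N) → (∀ {i j} → f i ≡ f j → i ≡ j) →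
                           ∀ y → ∃[ x ] f x ≡ y
Fin-injective⇒surjective {ℕ.suc N} f f-inj y with Fin.any? (λ x → f x Fin.≟ y)
... | yes found = found
... | no  ¬found = contradiction (Fin.injective⇒≤ {f = g} g-inj) (ℕ.<⇒≱ (ℕ.n<1+n N))
  where
  y≢f : ∀ x → ¬ y ≡ f x
  y≢f x y≡fx = ¬found (x , ≡.sym y≡fx)
  g : Fin (ℕ.suc N) → Fin N
  g x = punchOut (y≢f x)
  g-inj : ∀ {i j} → g i ≡ g j → i ≡ j
  g-inj {i} {j} e = f-inj (Fin.punchOut-injective (y≢f i) (y≢f j) e)

module Enumeration {N : ℕ} {S : Setoid 0ℓ 0ℓ} (finite : Finite N S) where
  open Setoid S
  open Inverse finite using (to-cong; from-cong; strictlyInverseˡ; strictlyInverseʳ) public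
    renaming (to to enum; from to index)

  index-injective : ∀ {x y} → index x ≡ index y → x ≈ y
  index-injective {x} {y} e =
    trans (sym (strictlyInverseˡ x)) (trans (to-cong e) (strictlyInverseˡ y))

  enum-injective : ∀ {i j} → enum i ≈ enum j → i ≡ j
  enum-injective {i} {j} e =
    ≡.trans (≡.sym (strictlyInverseʳ i)) (≡.trans (from-cong e) (strictlyInverseʳ j))

  infix 4 _≈?_
  _≈?_ : Decidable _≈_
  x ≈? y = map′ index-injective from-cong (index x Fin.≟ index y)

  any : ∀ {ℓ} {P : Pred Carrier ℓ} → P Respects _≈_ → (∀ x → Dec (P x)) → Dec (∃ P)
  any resp P? = map′ (λ (i , p) → enum i , p)
                     (λ (x , p) → index x , resp (sym (strictlyInverseˡ x)) p)
                     (Fin.any? (P? ∘ enum))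

  all : ∀ {ℓ} {P : Pred Carrier ℓ} → P Respects _≈_ → (∀ x → Dec (P x)) → Dec (∀ x → P x)
  all resp P? = map′ (λ h x → resp (strictlyInverseˡ x) (h (index x)))
                     (λ h i → h (enum i))
                     (Fin.all? (P? ∘ enum))

  injective⇒surjective : (f : Carrier → Carrier) → (∀ {x y} → f x ≈ f y → x ≈ y) →
                         ∀ y → ∃[ x ] f x ≈ y
  injective⇒surjective f f-inj y =
    let i , e = Fin-injective⇒surjective (index ∘ f ∘ enum)
                   (λ e → enum-injective (f-inj (index-injective e))) (index y)
    in enum i , index-injective e

infixl 8 _^ᶠ_
_^ᶠ_ : ∀ {N S} → Finite N S → ∀ k → Finite (N ^ k) (≋-setoid S k)
_^ᶠ_ {N} {S} finite k = record
  { to        = λ i → E.enum ∘ finToFun i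
  ; from      = λ f → funToFin (E.index ∘ f)
  ; to-cong   = λ { ≡.refl _ → S.refl }
  ; from-cong = λ f≋g → funToFin-cong (λ i → E.from-cong (f≋g i))
  ; inverse   =
      (λ {f} e i → S.trans (E.to-cong (≡.trans (≡.cong (λ c → finToFun c i) e)
                                         (Fin.finToFun-funToFin (E.index ∘ f) i)))
                            (E.strictlyInverseˡ (f i)))
    , (λ {i} e → ≡.trans (funToFin-cong {k} (λ j → ≡.trans (E.from-cong (e j)) (E.strictlyInverseʳ _)))
                          (Fin.funToFin-finToFin {k} {N} i))
  }
  where
  module E = Enumeration finite
  module S = Setoid S

-- Compares N^a with N^b. This count takes the place of the exchange lemma in all dimension
-- arguments below.
vector-injective⇒≤ : ∀ {N S} → Finite N S → 1 ℕ.< N → ∀ {a b} →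
                     let open Setoid S in
                     (Φ : (Fin a → Carrier) → (Fin b → Carrier)) →
                     (∀ {c d} → (∀ j → Φ c j ≈ Φ d j) → ∀ i → c i ≈ d i) → a ≤ b
vector-injective⇒≤ {N} finite 1<N {a} {b} Φ Φ-inj =
  ℕ.≮⇒≥ λ b<a → ℕ.<⇒≱ (ℕ.^-monoʳ-< N 1<N b<a)
    (Fin.injective⇒≤ {f = B.index ∘ Φ ∘ A.enum}
      λ e → A.enum-injective (Φ-inj (B.index-injective e)))
  where
  module A = Enumeration (finite ^ᶠ a)
  module B = Enumeration (finite ^ᶠ b)

-- Linear combinations

module _ (K : Field) where
  open Field K

  unitVector : ∀ {k} → Fin k → Fin k → Carrier
  unitVector zero    zero    = 1#
  unitVector zero    (suc j) = 0#
  unitVector (suc i) zero    = 0#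
  unitVector (suc i) (suc j) = unitVector i j

  unitVector-diagonal : ∀ {k} (i : Fin k) → unitVector i i ≡ 1#
  unitVector-diagonal zero    = ≡.refl
  unitVector-diagonal (suc i) = unitVector-diagonal i

module Combinations {K : Field} (V : VectorSpace K) where
  private module K = Field K
  open VectorSpace V
  private module S = Sum +ᴹ-commutativeMonoid
  open SetoidReasoning ≈ᴹ-setoid

  Independent : ∀ {k} → (Fin k → Carrierᴹ) → Set
  Independent b = ∀ c → lincomb V c b ≈ᴹ 0ᴹ → ∀ i → c i K.≈ K.0#

  InSpan : ∀ {k} → (Fin k → Carrierᴹ) → Carrierᴹ → Set
  InSpan b v = ∃[ c ] v ≈ᴹ lincomb V c b

  lincomb-cong : ∀ {k} {c d : Fin k → K.Carrier} {u v : Fin k → Carrierᴹ} →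
                 (∀ i → c i K.≈ d i) → (∀ i → u i ≈ᴹ v i) → lincomb V c u ≈ᴹ lincomb V d v
  lincomb-cong c≋d u≋v = S.sum-cong-≋ (λ i → *ₗ-cong (c≋d i) (u≋v i))

  lincomb-congˡ : ∀ {k} {c d : Fin k → K.Carrier} (b : Fin k → Carrierᴹ) →
                  (∀ i → c i K.≈ d i) → lincomb V c b ≈ᴹ lincomb V d b
  lincomb-congˡ b c≋d = lincomb-cong c≋d (λ _ → ≈ᴹ-refl)

  lincomb-congʳ : ∀ {k} (c : Fin k → K.Carrier) {u v : Fin k → Carrierᴹ} →
                  (∀ i → u i ≈ᴹ v i) → lincomb V c u ≈ᴹ lincomb V c v
  lincomb-congʳ c u≋v = lincomb-cong (λ _ → K.refl) u≋v

  lincomb-+ : ∀ {k} (c d : Fin k → K.Carrier) (b : Fin k → Carrierᴹ) →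
              lincomb V (λ i → c i K.+ d i) b ≈ᴹ lincomb V c b +ᴹ lincomb V d b
  lincomb-+ c d b = ≈ᴹ-trans (S.sum-cong-≋ (λ i → *ₗ-distribʳ (b i) (c i) (d i)))
                             (S.∑-distrib-+ (λ i → c i *ₗ b i) (λ i → d i *ₗ b i))

  lincomb-* : ∀ {k} a (c : Fin k → K.Carrier) (b : Fin k → Carrierᴹ) →
              lincomb V (λ i → a K.* c i) b ≈ᴹ a *ₗ lincomb V c b
  lincomb-* {ℕ.zero}  a c b = ≈ᴹ-sym (*ₗ-zeroʳ a)
  lincomb-* {ℕ.suc k} a c b = begin
    (a K.* c zero) *ₗ b zero +ᴹ _                    ≈⟨ +ᴹ-cong (*ₗ-assoc _ _ _) (lincomb-* a (c ∘ suc) (b ∘ suc)) ⟩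
    a *ₗ c zero *ₗ b zero +ᴹ a *ₗ lincomb V (c ∘ suc) (b ∘ suc) ≈⟨ *ₗ-distribˡ a _ _ ⟨
    a *ₗ lincomb V c b                               ∎

  lincomb-scaled : ∀ {k} (c d : Fin k → K.Carrier) (b : Fin k → Carrierᴹ) →
                   lincomb V c (λ i → d i *ₗ b i) ≈ᴹ lincomb V (λ i → c i K.* d i) b
  lincomb-scaled c d b = S.sum-cong-≋ (λ i → ≈ᴹ-sym (*ₗ-assoc (c i) (d i) (b i)))

  lincomb-0 : ∀ {k} (b : Fin k → Carrierᴹ) → lincomb V (λ _ → K.0#) b ≈ᴹ 0ᴹ
  lincomb-0 {k} b = ≈ᴹ-trans (S.sum-cong-≋ (λ i → *ₗ-zeroˡ (b i))) (S.sum-replicate-zero k)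

  lincomb-unit : ∀ {k} (i : Fin k) (b : Fin k → Carrierᴹ) → lincomb V (unitVector K i) b ≈ᴹ b i
  lincomb-unit zero    b =
    ≈ᴹ-trans (+ᴹ-cong (*ₗ-identityˡ _) (lincomb-0 (b ∘ suc))) (+ᴹ-identityʳ _)
  lincomb-unit (suc i) b =
    ≈ᴹ-trans (+ᴹ-cong (*ₗ-zeroˡ _) (lincomb-unit i (b ∘ suc))) (+ᴹ-identityˡ _)

  -- Not definitional: `_++_` goes through `splitAt`, which is stuck until its result on i is known.
  ++-suc : ∀ {m n} (y : Fin (ℕ.suc m) → Carrierᴹ) (x : Fin n → Carrierᴹ) i →
           (y ++ x) (suc i) ≡ ((y ∘ suc) ++ x) i
  ++-suc {m} y x i with splitAt m i
  ... | inj₁ _ = ≡.refl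
  ... | inj₂ _ = ≡.refl

  lincomb-++ : ∀ {m n} (c : Fin (m ℕ.+ n) → K.Carrier) (y : Fin m → Carrierᴹ) (x : Fin n → Carrierᴹ) →
               lincomb V c (y ++ x) ≈ᴹ lincomb V (c ∘ (_↑ˡ n)) y +ᴹ lincomb V (c ∘ (m ↑ʳ_)) x
  lincomb-++ {ℕ.zero}  c y x = ≈ᴹ-sym (+ᴹ-identityˡ _)
  lincomb-++ {ℕ.suc m} {n} c y x = begin
    c zero *ₗ y zero +ᴹ lincomb V (c ∘ suc) ((y ++ x) ∘ suc)
      ≈⟨ +ᴹ-congˡ (lincomb-cong (λ _ → K.refl) (λ i → ≈ᴹ-reflexive (++-suc y x i))) ⟩
    c zero *ₗ y zero +ᴹ lincomb V (c ∘ suc) ((y ∘ suc) ++ x)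
      ≈⟨ +ᴹ-congˡ (lincomb-++ (c ∘ suc) (y ∘ suc) x) ⟩
    c zero *ₗ y zero +ᴹ (lincomb V (c ∘ suc ∘ (_↑ˡ n)) (y ∘ suc) +ᴹ lincomb V (c ∘ suc ∘ (m ↑ʳ_)) x)
      ≈⟨ +ᴹ-assoc _ _ _ ⟨
    lincomb V (c ∘ (_↑ˡ n)) y +ᴹ lincomb V (c ∘ (ℕ.suc m ↑ʳ_)) x ∎

  -- Differences are written as a sum with a (-1)-multiple, here and below, because subspaces and
  -- linear combinations only provide sums and scalar multiples.
  a+-1b≈0⇒a≈b : ∀ {a b} → a K.+ (K.- K.1#) K.* b K.≈ K.0# → a K.≈ b
  a+-1b≈0⇒a≈b {a} {b} h = GroupProperties.x∙y⁻¹≈ε⇒x≈y K.+-group a b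
    (K.trans (K.+-congˡ (K.sym (RingProperties.-1*x≈-x K.ring b))) h)

  v+-1v≈0 : ∀ v → v +ᴹ (K.- K.1#) *ₗ v ≈ᴹ 0ᴹ
  v+-1v≈0 v = begin
    v +ᴹ (K.- K.1#) *ₗ v            ≈⟨ +ᴹ-congʳ (*ₗ-identityˡ v) ⟨
    K.1# *ₗ v +ᴹ (K.- K.1#) *ₗ v    ≈⟨ *ₗ-distribʳ v _ _ ⟨
    (K.1# K.+ K.- K.1#) *ₗ v        ≈⟨ *ₗ-congʳ (K.-‿inverseʳ K.1#) ⟩
    K.0# *ₗ v                       ≈⟨ *ₗ-zeroˡ v ⟩
    0ᴹ                              ∎

  u+-1v≈0⇒u≈v : ∀ {u v} → u +ᴹ (K.- K.1#) *ₗ v ≈ᴹ 0ᴹ → u ≈ᴹ v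
  u+-1v≈0⇒u≈v {u} {v} h = begin
    u                              ≈⟨ +ᴹ-identityʳ u ⟨
    u +ᴹ 0ᴹ                        ≈⟨ +ᴹ-congˡ (≈ᴹ-trans (+ᴹ-comm _ _) (v+-1v≈0 v)) ⟨
    u +ᴹ ((K.- K.1#) *ₗ v +ᴹ v)    ≈⟨ +ᴹ-assoc _ _ _ ⟨
    u +ᴹ (K.- K.1#) *ₗ v +ᴹ v      ≈⟨ +ᴹ-congʳ h ⟩
    0ᴹ +ᴹ v                        ≈⟨ +ᴹ-identityˡ v ⟩
    v                              ∎

  u+v≈0⇒u≈-1v : ∀ {u v} → u +ᴹ v ≈ᴹ 0ᴹ → u ≈ᴹ (K.- K.1#) *ₗ v
  u+v≈0⇒u≈-1v {u} {v} h = begin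
    u                              ≈⟨ +ᴹ-identityʳ u ⟨
    u +ᴹ 0ᴹ                        ≈⟨ +ᴹ-congˡ (v+-1v≈0 v) ⟨
    u +ᴹ (v +ᴹ (K.- K.1#) *ₗ v)    ≈⟨ +ᴹ-assoc _ _ _ ⟨
    u +ᴹ v +ᴹ (K.- K.1#) *ₗ v      ≈⟨ +ᴹ-congʳ h ⟩
    0ᴹ +ᴹ (K.- K.1#) *ₗ v          ≈⟨ +ᴹ-identityˡ _ ⟩
    (K.- K.1#) *ₗ v                ∎

  independent⇒unique : ∀ {k} {b : Fin k → Carrierᴹ} → Independent b →
                       ∀ {c d} → lincomb V c b ≈ᴹ lincomb V d b → ∀ i → c i K.≈ d i
  independent⇒unique {b = b} indep {c} {d} h i = a+-1b≈0⇒a≈b (indep _ (begin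
    lincomb V (λ i → c i K.+ (K.- K.1#) K.* d i) b       ≈⟨ lincomb-+ c _ b ⟩
    lincomb V c b +ᴹ lincomb V (λ i → (K.- K.1#) K.* d i) b ≈⟨ +ᴹ-cong h (lincomb-* _ d b) ⟩
    lincomb V d b +ᴹ (K.- K.1#) *ₗ lincomb V d b         ≈⟨ v+-1v≈0 _ ⟩
    0ᴹ ∎) i)

  lincomb∈ : ∀ {ℓ} (S : Subspace V ℓ) {k} c {b : Fin k → Carrierᴹ} →
             (∀ i → b i ∈ vectors S) → lincomb V c b ∈ vectors S
  lincomb∈ S {ℕ.zero}  c b∈ = Subspace.0∈ S
  lincomb∈ S {ℕ.suc k} c b∈ = Subspace.+∈ S (Subspace.*∈ S (c zero) (b∈ zero)) (lincomb∈ S (c ∘ suc) (b∈ ∘ suc))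

  linearSpan : ∀ {k} → (Fin k → Carrierᴹ) → Subspace V 0ℓ
  linearSpan b = record
    { vectors = InSpan b
    ; resp    = λ u≈v (c , e) → c , ≈ᴹ-trans (≈ᴹ-sym u≈v) e
    ; 0∈      = (λ _ → K.0#) , ≈ᴹ-sym (lincomb-0 b)
    ; +∈      = λ (c , e) (d , e′) → (λ i → c i K.+ d i) , ≈ᴹ-trans (+ᴹ-cong e e′) (≈ᴹ-sym (lincomb-+ c d b))
    ; *∈      = λ a (c , e) → (λ i → a K.* c i) , ≈ᴹ-trans (*ₗ-congˡ e) (≈ᴹ-sym (lincomb-* a c b))
    }

  linearSpan-hasDim : ∀ {k} {b : Fin k → Carrierᴹ} → Independent b → HasDim (linearSpan b) k
  linearSpan-hasDim {b = b} indep = record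
    { basis       = b
    ; basis∈      = λ i → unitVector K i , ≈ᴹ-sym (lincomb-unit i b)
    ; independent = indep
    ; spanning    = id
    }

  Span⊆ : ∀ {ℓ ℓ′} {X : Pred Carrierᴹ ℓ} (S : Subspace V ℓ′) → X ⊆ vectors S → Span V X ⊆ vectors S
  Span⊆ S X⊆S (Span.gen x)   = X⊆S x
  Span⊆ S X⊆S Span.zero      = Subspace.0∈ S
  Span⊆ S X⊆S (Span.add x y) = Subspace.+∈ S (Span⊆ S X⊆S x) (Span⊆ S X⊆S y)
  Span⊆ S X⊆S (Span.mul a x) = Subspace.*∈ S a (Span⊆ S X⊆S x)
  Span⊆ S X⊆S (Span.eq e x)  = Subspace.resp S e (Span⊆ S X⊆S x)

  inverse-scale : ∀ {a b} → a K.* b K.≈ K.1# → ∀ v → b *ₗ (a *ₗ v) ≈ᴹ v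
  inverse-scale {a} {b} ab≈1 v = begin
    b *ₗ a *ₗ v     ≈⟨ *ₗ-assoc _ _ _ ⟨
    (b K.* a) *ₗ v  ≈⟨ *ₗ-congʳ (K.trans (K.*-comm b a) ab≈1) ⟩
    K.1# *ₗ v       ≈⟨ *ₗ-identityˡ v ⟩
    v               ∎

  scale-injective : ∀ {a} → ¬ a K.≈ K.0# → ∀ {u v} → a *ₗ u ≈ᴹ a *ₗ v → u ≈ᴹ v
  scale-injective {a} a≉0 {u} {v} h =
    let b , ab≈1 = K.inverse a a≉0 in
    ≈ᴹ-trans (≈ᴹ-sym (inverse-scale ab≈1 u)) (≈ᴹ-trans (*ₗ-congˡ h) (inverse-scale ab≈1 v))

  scale≉0 : ∀ {a v} → ¬ a K.≈ K.0# → v ≉ᴹ 0ᴹ → a *ₗ v ≉ᴹ 0ᴹ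
  scale≉0 {a} a≉0 v≉0 h = v≉0 (scale-injective a≉0 (≈ᴹ-trans h (≈ᴹ-sym (*ₗ-zeroʳ a))))

  lincomb-++-≈0 : ∀ {m n} {y : Fin m → Carrierᴹ} {x : Fin n → Carrierᴹ} → Independent (y ++ x) →
                  ∀ c d → lincomb V c y +ᴹ lincomb V d x ≈ᴹ 0ᴹ →
                  (∀ i → c i K.≈ K.0#) × (∀ i → d i K.≈ K.0#)
  lincomb-++-≈0 {m} {n} {y} {x} indep c d h =
      (λ i → K.trans (K.sym (K.reflexive (≡.cong [ c , d ]′ (Fin.splitAt-↑ˡ m i n)))) (all0 (i ↑ˡ n)))
    , (λ i → K.trans (K.sym (K.reflexive (≡.cong [ c , d ]′ (Fin.splitAt-↑ʳ m n i)))) (all0 (m ↑ʳ i)))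
    where
    all0 : ∀ i → (c ++ d) i K.≈ K.0#
    all0 = indep (c ++ d) (≈ᴹ-trans (lincomb-++ (c ++ d) y x) (≈ᴹ-trans (+ᴹ-cong
      (lincomb-cong (λ i → K.reflexive (≡.cong [ c , d ]′ (Fin.splitAt-↑ˡ m i n))) (λ _ → ≈ᴹ-refl))
      (lincomb-cong (λ i → K.reflexive (≡.cong [ c , d ]′ (Fin.splitAt-↑ʳ m n i))) (λ _ → ≈ᴹ-refl))) h))

-- Semilinear maps

-- Nothing is asked of σ itself: linear maps are the case `id`, and properties of σ enter only in
-- the lemmas that use them.
record IsSemilinear {K K′ : Field} (σ : Field.Carrier K → Field.Carrier K′)
                    (V : VectorSpace K) (W : VectorSpace K′)
                    (f : VectorSpace.Carrierᴹ V → VectorSpace.Carrierᴹ W) : Set where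
  private
    module K = Field K
    module V = VectorSpace V
    module W = VectorSpace W
  field
    cong   : ∀ {u v} → u V.≈ᴹ v → f u W.≈ᴹ f v
    +-homo : ∀ u v → f (u V.+ᴹ v) W.≈ᴹ f u W.+ᴹ f v
    *-homo : ∀ a v → f (a V.*ₗ v) W.≈ᴹ σ a W.*ₗ f v

  0-homo : f V.0ᴹ W.≈ᴹ W.0ᴹ
  0-homo = GroupProperties.identityʳ-unique W.+ᴹ-group (f V.0ᴹ) (f V.0ᴹ)
    (W.≈ᴹ-trans (W.≈ᴹ-sym (+-homo _ _)) (cong (V.+ᴹ-identityˡ _)))

  -‿homo : ∀ v → f (V.-ᴹ v) W.≈ᴹ W.-ᴹ f v
  -‿homo v = GroupProperties.inverseʳ-unique W.+ᴹ-group (f v) (f (V.-ᴹ v))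
    (W.≈ᴹ-trans (W.≈ᴹ-sym (+-homo _ _)) (W.≈ᴹ-trans (cong (V.-ᴹ‿inverseʳ v)) 0-homo))

  lincomb-homo : ∀ {k} (c : Fin k → K.Carrier) (b : Fin k → V.Carrierᴹ) →
                 f (lincomb V c b) W.≈ᴹ lincomb W (σ ∘ c) (f ∘ b)
  lincomb-homo {ℕ.zero}  c b = 0-homo
  lincomb-homo {ℕ.suc k} c b =
    W.≈ᴹ-trans (+-homo _ _) (W.+ᴹ-cong (*-homo _ _) (lincomb-homo (c ∘ suc) (b ∘ suc)))

  kernel-trivial⇒injective : (∀ v → f v W.≈ᴹ W.0ᴹ → v V.≈ᴹ V.0ᴹ) →
                             ∀ {u v} → f u W.≈ᴹ f v → u V.≈ᴹ v
  kernel-trivial⇒injective ker {u} {v} fu≈fv =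
    GroupProperties.x∙y⁻¹≈ε⇒x≈y V.+ᴹ-group u v (ker _ (W.≈ᴹ-trans (+-homo _ _)
      (W.≈ᴹ-trans (W.+ᴹ-cong fu≈fv (-‿homo v)) (W.-ᴹ‿inverseʳ (f v)))))

-- A relation among the images is pulled back by choosing σ-preimages of its coefficients; this is
-- why σ must be surjective.
semilinear-independent :
  {K K′ : Field} {σ : Field.Carrier K → Field.Carrier K′} {V : VectorSpace K} {W : VectorSpace K′} →
  let module K = Field K
      module K′ = Field K′
      module V = VectorSpace V
      module W = VectorSpace W in
  {f : V.Carrierᴹ → W.Carrierᴹ} → IsSemilinear σ V W f →
  (∀ b → ∃[ a ] σ a K′.≈ b) → (∀ {a b} → a K.≈ b → σ a K′.≈ σ b) → σ K.0# K′.≈ K′.0# →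
  (∀ {u v} → f u W.≈ᴹ f v → u V.≈ᴹ v) →
  ∀ {k} {b : Fin k → V.Carrierᴹ} → Combinations.Independent V b → Combinations.Independent W (f ∘ b)
semilinear-independent {K′ = K′} {W = W} {f} F σ-surj σ-cong σ-0 f-inj {b = b} indep c h i =
  K′.trans (K′.sym (σd≈c i)) (K′.trans (σ-cong (indep d (f-inj
    (W.≈ᴹ-trans (F.lincomb-homo d b) (W.≈ᴹ-trans (Combinations.lincomb-congˡ W (f ∘ b) σd≈c)
    (W.≈ᴹ-trans h (W.≈ᴹ-sym F.0-homo))))) i)) σ-0)
  where
  module K′ = Field K′
  module W = VectorSpace W
  module F = IsSemilinear F
  d = λ i → proj₁ (σ-surj (c i))
  σd≈c = λ i → proj₂ (σ-surj (c i))

IsLinear : {K : Field} (V W : VectorSpace K) → (VectorSpace.Carrierᴹ V → VectorSpace.Carrierᴹ W) → Set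
IsLinear = IsSemilinear id

∘-isSemilinear : {K K′ K″ : Field} {σ : Field.Carrier K → Field.Carrier K′} {τ : Field.Carrier K′ → Field.Carrier K″}
                 {U : VectorSpace K} {V : VectorSpace K′} {W : VectorSpace K″}
                 {f : VectorSpace.Carrierᴹ U → VectorSpace.Carrierᴹ V}
                 {g : VectorSpace.Carrierᴹ V → VectorSpace.Carrierᴹ W} →
                 IsSemilinear τ V W g → IsSemilinear σ U V f →
                 IsSemilinear {K} {K″} (τ ∘ σ) U W (g ∘ f)
∘-isSemilinear {W = W} G F = record
  { cong   = λ e → G.cong (F.cong e)
  ; +-homo = λ u v → W.≈ᴹ-trans (G.cong (F.+-homo u v)) (G.+-homo _ _)
  ; *-homo = λ a v → W.≈ᴹ-trans (G.cong (F.*-homo a v)) (G.*-homo _ _)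
  }
  where
  module F = IsSemilinear F
  module G = IsSemilinear G
  module W = VectorSpace W

-- Coordinates

module Basis {K : Field} {V : VectorSpace K} {n : ℕ} (hasDim : HasDim (whole V) n) where
  private module K = Field K
  open VectorSpace V
  open Combinations V
  open HasDim hasDim public

  coord : Carrierᴹ → Fin n → K.Carrier
  coord v = proj₁ (spanning {v} tt)

  coord-spec : ∀ v → v ≈ᴹ lincomb V (coord v) basis
  coord-spec v = proj₂ (spanning {v} tt)

  coord-unique : ∀ {v c} → v ≈ᴹ lincomb V c basis → ∀ i → coord v i K.≈ c i
  coord-unique {v} e = independent⇒unique independent (≈ᴹ-trans (≈ᴹ-sym (coord-spec v)) e)

  coord-cong : ∀ {u v} → u ≈ᴹ v → ∀ i → coord u i K.≈ coord v i
  coord-cong {u} {v} u≈v = coord-unique (≈ᴹ-trans u≈v (coord-spec v))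

  module _ (W : VectorSpace K) where
    private
      module W = VectorSpace W
      module CW = Combinations W

    extend : (Fin n → W.Carrierᴹ) → Carrierᴹ → W.Carrierᴹ
    extend t v = lincomb W (coord v) t

    extend-isLinear : ∀ t → IsLinear V W (extend t)
    extend-isLinear t = record
      { cong   = λ e → CW.lincomb-cong (coord-cong e) (λ _ → W.≈ᴹ-refl)
      ; +-homo = λ u v → W.≈ᴹ-trans
          (CW.lincomb-cong (coord-unique (≈ᴹ-trans (+ᴹ-cong (coord-spec u) (coord-spec v))
                                                   (≈ᴹ-sym (lincomb-+ _ _ basis))))
                           (λ _ → W.≈ᴹ-refl))
          (CW.lincomb-+ _ _ t)
      ; *-homo = λ a v → W.≈ᴹ-trans
          (CW.lincomb-cong (coord-unique (≈ᴹ-trans (*ₗ-congˡ (coord-spec v))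
                                                   (≈ᴹ-sym (lincomb-* a _ basis))))
                           (λ _ → W.≈ᴹ-refl))
          (CW.lincomb-* a _ t)
      }

    extend-basis : ∀ t i → extend t (basis i) W.≈ᴹ t i
    extend-basis t i = W.≈ᴹ-trans
      (CW.lincomb-cong (coord-unique (≈ᴹ-sym (lincomb-unit i basis))) (λ _ → W.≈ᴹ-refl))
      (CW.lincomb-unit i t)

    linear-≗ : ∀ {f g} → IsLinear V W f → IsLinear V W g →
               (∀ i → f (basis i) W.≈ᴹ g (basis i)) → ∀ v → f v W.≈ᴹ g v
    linear-≗ F G e v =
      W.≈ᴹ-trans (F.cong (coord-spec v)) (W.≈ᴹ-trans (F.lincomb-homo _ basis)
      (W.≈ᴹ-trans (CW.lincomb-cong (λ _ → K.refl) e)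
      (W.≈ᴹ-sym (W.≈ᴹ-trans (G.cong (coord-spec v)) (G.lincomb-homo _ basis)))))
      where
      module F = IsSemilinear F
      module G = IsSemilinear G

  finite : ∀ {N} → Finite N (Field.setoid K) → Finite (N ^ n) ≈ᴹ-setoid
  finite fin = record
    { to        = λ i → lincomb V (E.enum i) basis
    ; from      = λ v → E.index (coord v)
    ; to-cong   = λ { ≡.refl → ≈ᴹ-refl }
    ; from-cong = λ e → E.from-cong (coord-cong e)
    ; inverse   =
        (λ {v} e → ≈ᴹ-trans (lincomb-cong (λ i → K.trans (E.to-cong e i) (E.strictlyInverseˡ (coord v) i))
                                           (λ _ → ≈ᴹ-refl))
                            (≈ᴹ-sym (coord-spec v)))
      , (λ {i} e → ≡.trans (E.from-cong (coord-unique e)) (E.strictlyInverseʳ i))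
    }
    where module E = Enumeration (fin ^ᶠ n)

-- Dimension over a finite field, by counting coefficient vectors

module FiniteField (K : Field) {N : ℕ} (order : HasOrder K N) where
  private
    module K = Field K
    module EK = Enumeration order
  open EK using () renaming (_≈?_ to _≈?_) public

  1<order : 1 ℕ.< N
  1<order = go EK.index (λ e → K.1≉0 (K.sym (EK.index-injective e)))
    where
    go : ∀ {M} (f : K.Carrier → Fin M) → ¬ f K.0# ≡ f K.1# → 1 ℕ.< M
    go {0} f _ with () ← f K.0#
    go {1} f f0≢f1 with f K.0# | f K.1#
    ... | zero | zero = contradiction ≡.refl f0≢f1
    go {ℕ.suc (ℕ.suc M)} f _ = ℕ.s≤s (ℕ.s≤s ℕ.z≤n)

  module _ (V : VectorSpace K) where
    open VectorSpace V
    open Combinations V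

    -- Rewriting combinations of x as combinations of y is an injective map from coefficient
    -- a-tuples to coefficient b-tuples.
    independent⇒≤ : ∀ {a b} {x : Fin a → Carrierᴹ} {y : Fin b → Carrierᴹ} → Independent x →
                    (∀ c → InSpan y (lincomb V c x)) → a ≤ b
    independent⇒≤ indep x⊆y = vector-injective⇒≤ order 1<order (λ c → proj₁ (x⊆y c))
      λ {c} {d} h → independent⇒unique indep
        (≈ᴹ-trans (proj₂ (x⊆y c)) (≈ᴹ-trans (lincomb-cong h (λ _ → ≈ᴹ-refl)) (≈ᴹ-sym (proj₂ (x⊆y d)))))

    -- Passing from x-coefficients to basis coefficients is injective on the finite set of n-tuples,
    -- hence surjective, so the coordinates of v are attained.
    independent⇒spanning : ∀ {ℓ n} {S : Subspace V ℓ} → HasDim S n →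
                           {x : Fin n → Carrierᴹ} → (∀ i → x i ∈ vectors S) → Independent x →
                           ∀ {v} → v ∈ vectors S → InSpan x v
    independent⇒spanning {n = n} {S} hasDim {x} x∈S indep {v} v∈S =
      let c , e = Enumeration.injective⇒surjective (order ^ᶠ n) Φ
                    (λ {c} {d} h → independent⇒unique indep
                       (≈ᴹ-trans (Φ-spec c) (≈ᴹ-trans (lincomb-cong h (λ _ → ≈ᴹ-refl)) (≈ᴹ-sym (Φ-spec d)))))
                    (proj₁ (H.spanning v∈S))
      in c , ≈ᴹ-trans (proj₂ (H.spanning v∈S))
               (≈ᴹ-sym (≈ᴹ-trans (Φ-spec c) (lincomb-cong e (λ _ → ≈ᴹ-refl))))
      where
      module H = HasDim hasDim
      Φ : (Fin n → K.Carrier) → (Fin n → K.Carrier)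
      Φ c = proj₁ (H.spanning (lincomb∈ S c x∈S))
      Φ-spec : ∀ c → lincomb V c x ≈ᴹ lincomb V (Φ c) H.basis
      Φ-spec c = proj₂ (H.spanning (lincomb∈ S c x∈S))

    independent-∷ : ∀ {k} {z : Fin k → Carrierᴹ} {v} → Independent z → ¬ InSpan z v → Independent (v ∷ z)
    independent-∷ {k} {z} {v} indep v∉z c h = by-head (c zero ≈? K.0#)
      where
      by-head : Dec (c zero K.≈ K.0#) → ∀ i → c i K.≈ K.0#
      by-head (yes c₀≈0) zero    = c₀≈0
      by-head (yes c₀≈0) (suc i) = indep (c ∘ suc)
        (≈ᴹ-trans (≈ᴹ-sym (≈ᴹ-trans (+ᴹ-congʳ (≈ᴹ-trans (*ₗ-congʳ c₀≈0) (*ₗ-zeroˡ v))) (+ᴹ-identityˡ _))) h) i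
      -- An invertible leading coefficient would express v through z.
      by-head (no c₀≉0) i = contradiction
        (Subspace.resp (linearSpan z) (inverse-scale (proj₂ (K.inverse _ c₀≉0)) v)
          (Subspace.*∈ (linearSpan z) _
            (Subspace.resp (linearSpan z) (≈ᴹ-sym (u+v≈0⇒u≈-1v h))
              (Subspace.*∈ (linearSpan z) _ (c ∘ suc , ≈ᴹ-refl)))))
        v∉z

    module _ (_≟ᴹ_ : Decidable _≈ᴹ_) where

      inSpan? : ∀ {k} (z : Fin k → Carrierᴹ) v → Dec (InSpan z v)
      inSpan? {k} z v = Enumeration.any (order ^ᶠ k)
        (λ c≋d e → ≈ᴹ-trans e (lincomb-cong c≋d (λ _ → ≈ᴹ-refl)))
        (λ c → v ≟ᴹ lincomb V c z)

      -- `added∈` keeps track of where the new vectors come from: if every `e i` lies in a kernel,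
      -- so does every added vector, as `liftBasis` requires.
      record Extension {r k} (x : Fin r → Carrierᴹ) (e : Fin k → Carrierᴹ) : Set where
        field
          {size}      : ℕ
          added       : Fin size → Carrierᴹ
          independent : Independent (added ++ x)
          spanning    : ∀ i → InSpan (added ++ x) (e i)
          added∈      : ∀ j → ∃[ i ] added j ≡ e i

      extendIndependent : ∀ {r} {x : Fin r → Carrierᴹ} → Independent x →
                          ∀ {k} (e : Fin k → Carrierᴹ) → Extension x e
      extendIndependent {r} {x} indep {ℕ.zero} e = record
        { added = λ () ; independent = indep ; spanning = λ () ; added∈ = λ () }
      extendIndependent {r} {x} indep {ℕ.suc k} e = step (inSpan? (E.added ++ x) (e zero))
        where
        module E = Extension (extendIndependent indep (e ∘ suc))
        step : Dec (InSpan (E.added ++ x) (e zero)) → Extension x e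
        step (yes e₀∈) = record
          { added       = E.added
          ; independent = E.independent
          ; spanning    = λ { zero → e₀∈ ; (suc i) → E.spanning i }
          ; added∈      = λ j → let i , p = E.added∈ j in suc i , p
          }
        step (no e₀∉) = record
          { added       = e zero ∷ E.added
          ; independent = λ c h → independent-∷ E.independent e₀∉ c (≈ᴹ-trans (lincomb-congʳ c reassociate) h)
          ; spanning    = λ { zero    → unitVector K zero , ≈ᴹ-sym (lincomb-unit zero ((e zero ∷ E.added) ++ x))
                            ; (suc i) → let c , p = E.spanning i in K.0# ∷ c ,
                                ≈ᴹ-trans p (≈ᴹ-trans (≈ᴹ-sym (≈ᴹ-trans (+ᴹ-congʳ (*ₗ-zeroˡ _)) (+ᴹ-identityˡ _)))
                                                     (lincomb-congʳ (K.0# ∷ c) reassociate)) }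
          ; added∈      = λ { zero → zero , ≡.refl ; (suc j) → let i , p = E.added∈ j in suc i , p }
          }
          where
          reassociate : ∀ i → (e zero ∷ (E.added ++ x)) i ≈ᴹ ((e zero ∷ E.added) ++ x) i
          reassociate zero    = ≈ᴹ-refl
          reassociate (suc i) = ≈ᴹ-sym (≈ᴹ-reflexive (++-suc (e zero ∷ E.added) x i))

-- Points

module Points {K : Field} (_≈?_ : Decidable (Field._≈_ K)) (V : VectorSpace K) where
  private module K = Field K
  open VectorSpace V
  open Combinations V

  lincomb₁ : ∀ (c : Fin 1 → K.Carrier) b → lincomb V c b ≈ᴹ c zero *ₗ b zero
  lincomb₁ c b = +ᴹ-identityʳ _

  scale≈0 : ∀ {a v} → v ≉ᴹ 0ᴹ → a *ₗ v ≈ᴹ 0ᴹ → a K.≈ K.0#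
  scale≈0 {a} v≉0 av≈0 with a ≈? K.0#
  ... | yes a≈0 = a≈0
  ... | no  a≉0 = contradiction av≈0 (scale≉0 a≉0 v≉0)

  oneDimensional : ∀ {ℓ} (S : Subspace V ℓ) {w} → w ∈ vectors S → w ≉ᴹ 0ᴹ →
                   (∀ {v} → v ∈ vectors S → ∃[ a ] v ≈ᴹ a *ₗ w) → HasDim S 1
  oneDimensional S {w} w∈S w≉0 spans = record
    { basis       = λ _ → w
    ; basis∈      = λ _ → w∈S
    ; independent = λ { c h zero → scale≈0 w≉0 (≈ᴹ-trans (≈ᴹ-sym (lincomb₁ c (λ _ → w))) h) }
    ; spanning    = λ v∈S → let a , e = spans v∈S in
                      (λ _ → a) , ≈ᴹ-trans e (≈ᴹ-sym (lincomb₁ (λ _ → a) (λ _ → w)))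
    }

  line : Carrierᴹ → Subspace V 0ℓ
  line w = record
    { vectors = λ v → ∃[ a ] v ≈ᴹ a *ₗ w
    ; resp    = λ u≈v (a , e) → a , ≈ᴹ-trans (≈ᴹ-sym u≈v) e
    ; 0∈      = K.0# , ≈ᴹ-sym (*ₗ-zeroˡ w)
    ; +∈      = λ (a , e) (b , e′) → a K.+ b , ≈ᴹ-trans (+ᴹ-cong e e′) (≈ᴹ-sym (*ₗ-distribʳ w a b))
    ; *∈      = λ a (b , e) → a K.* b , ≈ᴹ-trans (*ₗ-congˡ e) (≈ᴹ-sym (*ₗ-assoc a b w))
    }

  ∈-line : ∀ w → w ∈ vectors (line w)
  ∈-line w = K.1# , ≈ᴹ-sym (*ₗ-identityˡ w)

  line⊆ : ∀ {ℓ} (S : Subspace V ℓ) {w} → w ∈ vectors S → vectors (line w) ⊆ vectors S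
  line⊆ S w∈S (a , e) = Subspace.resp S (≈ᴹ-sym e) (Subspace.*∈ S a w∈S)

  point : ∀ w → w ≉ᴹ 0ᴹ → Point V
  point w w≉0 = record { subspace = line w ; oneDim = oneDimensional (line w) (∈-line w) w≉0 id }

  line≐Span : ∀ w → vectors (line w) ≐ Span V (_≈ᴹ w)
  line≐Span w = (λ (a , e) → Span.eq (≈ᴹ-sym e) (Span.mul a (Span.gen ≈ᴹ-refl)))
              , Span⊆ (line w) (λ e → Subspace.resp (line w) (≈ᴹ-sym e) (∈-line w))

  module _ (P : Point V) where
    private
      module P = Subspace (Point.subspace P)
      module D = HasDim (Point.oneDim P)

    generator : ∃[ v ] v ∈ pvectors P × v ≉ᴹ 0ᴹ
    generator = D.basis zero , D.basis∈ zero , λ b≈0 → K.1≉0 (D.independent (λ _ → K.1#)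
      (≈ᴹ-trans (lincomb₁ (λ _ → K.1#) D.basis) (≈ᴹ-trans (*ₗ-identityˡ _) b≈0)) zero)

    -- The nonzero w is an invertible multiple of the basis vector of P, so the basis vector is in
    -- turn a multiple of w.
    generates : ∀ {w v} → w ∈ pvectors P → w ≉ᴹ 0ᴹ → v ∈ pvectors P → v ∈ vectors (line w)
    generates {w} {v} w∈P w≉0 v∈P =
      let c , w≈ = D.spanning w∈P
          d , v≈ = D.spanning v∈P
          w≈c₀b  = ≈ᴹ-trans w≈ (lincomb₁ c D.basis)
          c₀≉0   = λ c₀≈0 → w≉0 (≈ᴹ-trans w≈c₀b (≈ᴹ-trans (*ₗ-congʳ c₀≈0) (*ₗ-zeroˡ _)))
          a , ca≈1 = K.inverse (c zero) c₀≉0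
          b∈line : D.basis zero ∈ vectors (line w)
          b∈line = a , ≈ᴹ-trans (≈ᴹ-sym (inverse-scale ca≈1 _)) (*ₗ-congˡ (≈ᴹ-sym w≈c₀b))
      in Subspace.resp (line w) (≈ᴹ-sym (≈ᴹ-trans v≈ (lincomb₁ d D.basis)))
           (Subspace.*∈ (line w) (d zero) b∈line)

    ⊆-by-generator : ∀ {ℓ} (S : Subspace V ℓ) {w} → w ∈ pvectors P → w ≉ᴹ 0ᴹ →
                     w ∈ vectors S → pvectors P ⊆ vectors S
    ⊆-by-generator S w∈P w≉0 w∈S v∈P = line⊆ S w∈S (generates w∈P w≉0 v∈P)

-- Assembling automorphisms from their essential laws

ringIsomorphism : {K : Field} → let open Field K in (σ : Carrier → Carrier) →
  (∀ {a b} → a ≈ b → σ a ≈ σ b) → (∀ a b → σ (a + b) ≈ σ a + σ b) →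
  (∀ a b → σ (a * b) ≈ σ a * σ b) → σ 1# ≈ 1# →
  (∀ {a b} → σ a ≈ σ b → a ≈ b) → (∀ b → ∃[ a ] σ a ≈ b) →
  RingMorphisms.IsRingIsomorphism rawRing rawRing σ
ringIsomorphism {K} σ σ-cong σ-+ σ-* σ-1 σ-inj σ-surj = record
  { isRingMonomorphism = record
    { isRingHomomorphism = record
      { isSemiringHomomorphism = record
        { isNearSemiringHomomorphism = record
          { +-isMonoidHomomorphism = record
            { isMagmaHomomorphism = record
              { isRelHomomorphism = record { cong = σ-cong }
              ; homo = σ-+
              }
            ; ε-homo = σ-0
            }
          ; *-homo = σ-*
          }
        ; 1#-homo = σ-1
        }
      ; -‿homo = λ a → G.inverseʳ-unique (σ a) (σ (- a))
                         (trans (sym (σ-+ _ _)) (trans (σ-cong (-‿inverseʳ a)) σ-0))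
      }
    ; injective = σ-inj
    }
  ; surjective = λ b → let a , e = σ-surj b in a , λ z≈a → trans (σ-cong z≈a) e
  }
  where
  open Field K
  module G = GroupProperties +-group
  σ-0 : σ 0# ≈ 0#
  σ-0 = G.identityʳ-unique (σ 0#) (σ 0#) (trans (sym (σ-+ _ _)) (σ-cong (+-identityˡ 0#)))

semilinearAutomorphism : {K : Field} {V : VectorSpace K} {σ : Field.Carrier K → Field.Carrier K} →
  RingMorphisms.IsRingIsomorphism (Field.rawRing K) (Field.rawRing K) σ →
  let open VectorSpace V in {f : Carrierᴹ → Carrierᴹ} → IsSemilinear σ V V f →
  (∀ {u v} → f u ≈ᴹ f v → u ≈ᴹ v) → (∀ v → ∃[ u ] f u ≈ᴹ v) → SemilinearAutomorphism V
semilinearAutomorphism {V = V} {σ} σ-iso {f} semilinear f-inj f-surj = record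
  { σ = σ
  ; σ-isAutomorphism = σ-iso
  ; f = f
  ; isGroupIsomorphism = record
    { isGroupMonomorphism = record
      { isGroupHomomorphism = record
        { isMonoidHomomorphism = record
          { isMagmaHomomorphism = record
            { isRelHomomorphism = record { cong = F.cong }
            ; homo = F.+-homo
            }
          ; ε-homo = F.0-homo
          }
        ; ⁻¹-homo = F.-‿homo
        }
      ; injective = f-inj
      }
    ; surjective = λ v → let u , e = f-surj v in u , λ z≈u → V.≈ᴹ-trans (F.cong z≈u) e
    }
  ; semilinear = F.*-homo
  }
  where
  module F = IsSemilinear semilinear
  module V = VectorSpace V

-- The collineation induced by a semilinear automorphism

module Automorphism {K : Field} {V : VectorSpace K} (h : SemilinearAutomorphism V) where
  private module K = Field K
  open VectorSpace V
  open SemilinearAutomorphism h public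
  open RingMorphisms.IsRingIsomorphism σ-isAutomorphism public using ()
    renaming (⟦⟧-cong to σ-cong; +-homo to σ-+; *-homo to σ-*; 1#-homo to σ-1; 0#-homo to σ-0; -‿homo to σ-neg;
              injective to σ-injective; surjective to σ-surj)
  open GroupMorphisms.IsGroupIsomorphism isGroupIsomorphism public using ()
    renaming (⟦⟧-cong to f-cong; ∙-homo to f-+; injective to f-injective; surjective to f-surj)

  isSemilinear : IsSemilinear σ V V f
  isSemilinear = record { cong = f-cong ; +-homo = f-+ ; *-homo = semilinear }

  open IsSemilinear isSemilinear using () renaming (0-homo to f-0)

  σ-surjective : ∀ b → ∃[ a ] σ a K.≈ b
  σ-surjective b = let a , e = σ-surj b in a , e K.refl

  f-surjective : ∀ v → ∃[ u ] f u ≈ᴹ v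
  f-surjective v = let u , e = f-surj v in u , e ≈ᴹ-refl

  f≉0 : ∀ {v} → v ≉ᴹ 0ᴹ → f v ≉ᴹ 0ᴹ
  f≉0 v≉0 fv≈0 = v≉0 (f-injective (≈ᴹ-trans fv≈0 (≈ᴹ-sym f-0)))

  imageSubspace : Subspace V 0ℓ → Subspace V 0ℓ
  imageSubspace S = record
    { vectors = image _≈ᴹ_ f (vectors S)
    ; resp    = λ u≈v (x , x∈S , e) → x , x∈S , ≈ᴹ-trans e u≈v
    ; 0∈      = 0ᴹ , S.0∈ , f-0
    ; +∈      = λ (x , x∈S , e) (y , y∈S , e′) → x +ᴹ y , S.+∈ x∈S y∈S , ≈ᴹ-trans (f-+ x y) (+ᴹ-cong e e′)
    ; *∈      = λ a (x , x∈S , e) → let b , σb≈a = σ-surjective a in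
                  b *ₗ x , S.*∈ b x∈S , ≈ᴹ-trans (semilinear b x) (*ₗ-cong σb≈a e)
    }
    where module S = Subspace S

  preimageSubspace : Subspace V 0ℓ → Subspace V 0ℓ
  preimageSubspace S = record
    { vectors = λ v → f v ∈ vectors S
    ; resp    = λ u≈v → S.resp (f-cong u≈v)
    ; 0∈      = S.resp (≈ᴹ-sym f-0) S.0∈
    ; +∈      = λ u∈ v∈ → S.resp (≈ᴹ-sym (f-+ _ _)) (S.+∈ u∈ v∈)
    ; *∈      = λ a v∈ → S.resp (≈ᴹ-sym (semilinear _ _)) (S.*∈ _ v∈)
    }
    where module S = Subspace S

  module Collineation (_≈?_ : Decidable K._≈_) where
    open Points _≈?_ V

    imagePoint : Point V → Point V
    imagePoint P = record
      { subspace = imageSubspace (Point.subspace P)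
      ; oneDim   = oneDimensional (imageSubspace (Point.subspace P)) (w , w∈P , ≈ᴹ-refl) (f≉0 w≉0)
          λ (x , x∈P , e) → let a , x≈aw = generates P w∈P w≉0 x∈P in
            σ a , ≈ᴹ-trans (≈ᴹ-sym e) (≈ᴹ-trans (f-cong x≈aw) (semilinear a w))
      }
      where
      w = proj₁ (generator P)
      w∈P = proj₁ (proj₂ (generator P))
      w≉0 = proj₂ (proj₂ (generator P))

    preimagePoint : Point V → Point V
    preimagePoint P = record
      { subspace = preimageSubspace (Point.subspace P)
      ; oneDim   = oneDimensional (preimageSubspace (Point.subspace P)) {x}
          (Subspace.resp (Point.subspace P) (≈ᴹ-sym fx≈w) w∈P)
          (λ x≈0 → w≉0 (≈ᴹ-trans (≈ᴹ-sym fx≈w) (≈ᴹ-trans (f-cong x≈0) f-0)))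
          λ {v} fv∈P → let a , fv≈aw = generates P w∈P w≉0 fv∈P
                           b , σb≈a = σ-surjective a in
            b , f-injective (≈ᴹ-trans fv≈aw (≈ᴹ-trans (≈ᴹ-sym (*ₗ-cong σb≈a fx≈w)) (≈ᴹ-sym (semilinear b x))))
      }
      where
      w = proj₁ (generator P)
      w∈P = proj₁ (proj₂ (generator P))
      w≉0 = proj₂ (proj₂ (generator P))
      x = proj₁ (f-surjective w)
      fx≈w = proj₂ (f-surjective w)

    imagePoint-preimagePoint : ∀ P → imagePoint (preimagePoint P) ≃ P
    imagePoint-preimagePoint P =
        (λ (x , fx∈P , e) → Subspace.resp (Point.subspace P) e fx∈P)
      , (λ {v} v∈P → let x , e = f-surjective v in
           x , Subspace.resp (Point.subspace P) (≈ᴹ-sym e) v∈P , e)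

    isCollineation : IsCollineation V imagePoint
    isCollineation = record
      { bijective  = (λ {P} {Q} (P⊆ , Q⊆) → (λ v∈P → reflects Q (P⊆ (_ , v∈P , ≈ᴹ-refl)))
                                          , (λ v∈Q → reflects P (Q⊆ (_ , v∈Q , ≈ᴹ-refl))))
                   , (λ Q → preimagePoint Q , λ (Z⊆ , ⊆Z) →
                        (λ (x , x∈Z , e) → proj₁ (imagePoint-preimagePoint Q) (x , Z⊆ x∈Z , e))
                      , (λ v∈Q → let x , x∈ , e = proj₂ (imagePoint-preimagePoint Q) v∈Q in
                           x , ⊆Z x∈ , e))
      ; semilinear = h
      ; isInduced  = λ P → id , id
      }
      where
      reflects : ∀ (Q : Point V) {v} → f v ∈ image _≈ᴹ_ f (pvectors Q) → v ∈ pvectors Q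
      reflects Q (u , u∈Q , e) = Subspace.resp (Point.subspace Q) (f-injective e) u∈Q

    points-imagePoint : (S T : Subspace V 0ℓ) → (∀ {v} → v ∈ vectors S → f v ∈ vectors T) →
                        (∀ {v} → f v ∈ vectors T → v ∈ vectors S) →
                        points S ^^ imagePoint ≐ points T
    points-imagePoint S T to from =
        (λ (P , P⊆S , βP⊆Q , Q⊆βP) v∈Q → let x , x∈P , e = Q⊆βP v∈Q in
           Subspace.resp T e (to (P⊆S x∈P)))
      , (λ {Q} Q⊆T → preimagePoint Q , (λ fv∈Q → from (Q⊆T fv∈Q)) , imagePoint-preimagePoint Q)

-- Field reduction and collineations preserving the Desarguesian spread

module Reduction {F K : Field} (φ : FieldExtension F K) {q N : ℕ}
                 (orderF : HasOrder F q) (orderK : HasOrder K N) (R : VectorSpace K) where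
  private
    module F = Field F
    module K = Field K
    module φ = FieldExtension φ
    module FF = FiniteField F orderF
    module FK = FiniteField K orderK
  open VectorSpace R
  open Combinations R

  Rq : VectorSpace F
  Rq = restrictScalars φ R

  private
    module Rq = Combinations Rq
    module PF = Points FF._≈?_ Rq

  -- A witnessing point over F amounts to a common nonzero vector of P and S; later arguments about
  -- `𝓑` work with that vector.
  ∈𝓑⇒ : (S : Subspace Rq 0ℓ) {P : Point R} → P ∈ 𝓑 φ R S →
        ∃[ v ] v ∈ pvectors P × v ∈ vectors S × v ≉ᴹ 0ᴹ
  ∈𝓑⇒ S (Q , Q⊆P , Q⊆S) = let v , v∈Q , v≉0 = PF.generator Q in v , Q⊆P v∈Q , Q⊆S v∈Q , v≉0

  ∈𝓑⇐ : (S : Subspace Rq 0ℓ) {P : Point R} →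
        ∃[ v ] v ∈ pvectors P × v ∈ vectors S × v ≉ᴹ 0ᴹ → P ∈ 𝓑 φ R S
  ∈𝓑⇐ S {P} (v , v∈P , v∈S , v≉0) =
    PF.point v v≉0 , PF.line⊆ (fieldReduction φ R P) v∈P , PF.line⊆ S v∈S

  -- The additive map underlying h is semilinear over F as well, for the restriction τ of σ.
  module Descent (h : SemilinearAutomorphism R)
                 (preserves : ∀ a → ∃[ b ] SemilinearAutomorphism.σ h (φ.embed a) K.≈ φ.embed b) where
    open Automorphism h

    τ : F.Carrier → F.Carrier
    τ a = proj₁ (preserves a)

    τ-spec : ∀ a → σ (φ.embed a) K.≈ φ.embed (τ a)
    τ-spec a = proj₂ (preserves a)

    τ-injective : ∀ {a b} → τ a F.≈ τ b → a F.≈ b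
    τ-injective {a} {b} e = φ.injective (σ-injective
      (K.trans (τ-spec a) (K.trans (φ.⟦⟧-cong e) (K.sym (τ-spec b)))))

    h-F : SemilinearAutomorphism Rq
    h-F = semilinearAutomorphism {F} {Rq} {τ}
      (ringIsomorphism {F} τ
        (λ {a} {b} e → φ.injective (K.trans (K.sym (τ-spec a)) (K.trans (σ-cong (φ.⟦⟧-cong e)) (τ-spec b))))
        (λ a b → φ.injective (K.trans (K.sym (τ-spec _)) (K.trans (σ-cong (φ.+-homo a b)) (K.trans (σ-+ _ _)
                   (K.trans (K.+-cong (τ-spec a) (τ-spec b)) (K.sym (φ.+-homo _ _)))))))
        (λ a b → φ.injective (K.trans (K.sym (τ-spec _)) (K.trans (σ-cong (φ.*-homo a b)) (K.trans (σ-* _ _)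
                   (K.trans (K.*-cong (τ-spec a) (τ-spec b)) (K.sym (φ.*-homo _ _)))))))
        (φ.injective (K.trans (K.sym (τ-spec _)) (K.trans (σ-cong φ.1#-homo) (K.trans σ-1 (K.sym φ.1#-homo)))))
        τ-injective
        -- `preserves` only says that σ maps F into F; τ is onto because F is finite.
        (Enumeration.injective⇒surjective orderF τ τ-injective))
      {f} (record { cong = f-cong ; +-homo = f-+ ; *-homo = λ a v → ≈ᴹ-trans (semilinear _ v) (*ₗ-congʳ (τ-spec a)) })
      f-injective f-surjective

    open Collineation FK._≈?_ using () renaming (imagePoint to imageK; preimagePoint to preimageK; isCollineation to collineationK)
    open Automorphism.Collineation h-F FF._≈?_ using () renaming (imagePoint to γ; isCollineation to γ-isCollineation; points-imagePoint to points-γ)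

    γ-preservesSpread : PreservesSpread φ R γ
    γ-preservesSpread = record
      { into = λ P → imageK P , points-γ (fieldReduction φ R P) (fieldReduction φ R (imageK P))
          (λ v∈P → _ , v∈P , ≈ᴹ-refl)
          (λ (x , x∈P , e) → Subspace.resp (Point.subspace P) (f-injective e) x∈P)
      ; onto = λ P → preimageK P , points-γ (fieldReduction φ R (preimageK P)) (fieldReduction φ R P) id id
      }

    -- Inclusion of f(U) in U′ is enough: the images of a basis of U are n vectors of U′ independent
    -- over F, hence span U′, so f(U) = U′.
    moves : ∀ {n} (U U′ : Subspace Rq 0ℓ) → HasDim U n → HasDim U′ n →
            (∀ {v} → v ∈ vectors U → f v ∈ vectors U′) →
            ∃[ γ ] IsCollineation Rq γ × points U ^^ γ ≐ points U′ ×
                   Σ (PreservesSpread φ R γ) λ pr → IsCollineation R (PreservesSpread.inducedMap pr)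
    moves U U′ dimU dimU′ fU⊆U′ =
      γ , γ-isCollineation , points-γ U U′ fU⊆U′ fU⊇U′ , γ-preservesSpread , collineationK
      where
      module U = HasDim dimU
      module hF = Automorphism h-F
      fbasis-independent : Rq.Independent (f ∘ U.basis)
      fbasis-independent =
        semilinear-independent hF.isSemilinear hF.σ-surjective hF.σ-cong hF.σ-0 f-injective U.independent
      fU⊇U′ : ∀ {v} → f v ∈ vectors U′ → v ∈ vectors U
      fU⊇U′ {v} fv∈U′ =
        let c , fv≈ = FF.independent⇒spanning Rq {S = U′} dimU′ (fU⊆U′ ∘ U.basis∈) fbasis-independent fv∈U′
            d i = proj₁ (hF.σ-surjective (c i))
            τd≈c i = proj₂ (hF.σ-surjective (c i))
        in Subspace.resp U (f-injective
             (≈ᴹ-trans (IsSemilinear.lincomb-homo hF.isSemilinear d U.basis)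
             (≈ᴹ-trans (Rq.lincomb-congˡ (f ∘ U.basis) τd≈c) (≈ᴹ-sym fv≈))))
             (Rq.lincomb∈ U d U.basis∈)

-- Deciding whether a semilinear automorphism carries one basis to another

module Functions {N : ℕ} {S : Setoid 0ℓ 0ℓ} (finite : Finite N S) where
  open Setoid S
  private module E = Enumeration finite

  -- Runs through all setoid maps up to pointwise equality, so that looking for a map is a search
  -- over a finite index set.
  table : Fin (N ^ N) → Carrier → Carrier
  table t x = E.enum (finToFun t (E.index x))

  table-cong : ∀ t {x y} → x ≈ y → table t x ≈ table t y
  table-cong t x≈y = E.to-cong (≡.cong (finToFun t) (E.from-cong x≈y))

  tabulate : (f : Carrier → Carrier) → (∀ {x y} → x ≈ y → f x ≈ f y) →
             ∃[ t ] ∀ x → table t x ≈ f x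
  tabulate f f-cong = funToFin g , λ x →
    trans (E.to-cong (Fin.finToFun-funToFin g (E.index x)))
          (trans (E.strictlyInverseˡ _) (f-cong (E.strictlyInverseˡ x)))
    where
    g : Fin N → Fin N
    g = E.index ∘ f ∘ E.enum

  injective? : (f : Carrier → Carrier) → (∀ {x y} → x ≈ y → f x ≈ f y) →
               Dec (∀ x y → f x ≈ f y → x ≈ y)
  injective? f f-cong = E.all
    (λ x≈x′ h y e → trans (sym x≈x′) (h y (trans (f-cong x≈x′) e)))
    (λ x → E.all (λ y≈y′ h e → trans (h (trans e (sym (f-cong y≈y′)))) y≈y′)
                 (λ y → (f x E.≈? f y) →-dec (x E.≈? y)))

equal? : ∀ {M N P} {S T U : Setoid 0ℓ 0ℓ} → Finite M S → Finite N T → Finite P U →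
         let module S = Setoid S
             module T = Setoid T
             module U = Setoid U in
         (f g : S.Carrier → T.Carrier → U.Carrier) →
         (∀ {x x′ y y′} → x S.≈ x′ → y T.≈ y′ → f x y U.≈ f x′ y′) →
         (∀ {x x′ y y′} → x S.≈ x′ → y T.≈ y′ → g x y U.≈ g x′ y′) →
         Dec (∀ x y → f x y U.≈ g x y)
equal? {S = S} {T} {U} finS finT finU f g f-cong g-cong = Enumeration.all finS
  (λ x≈x′ h y → U.trans (U.sym (f-cong x≈x′ T.refl)) (U.trans (h y) (g-cong x≈x′ T.refl)))
  (λ x → Enumeration.all finT
    (λ y≈y′ e → U.trans (U.sym (f-cong S.refl y≈y′)) (U.trans e (g-cong S.refl y≈y′)))
    (λ y → Enumeration._≈?_ finU (f x y) (g x y)))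
  where
  module S = Setoid S
  module T = Setoid T
  module U = Setoid U

projDim⇒dim : {K : Field} {V : VectorSpace K} {S : Subspace V 0ℓ} {n : ℕ} →
              HasProjDim S (+ n - 1ℤ) → HasDim S n
projDim⇒dim {S = S} {n} (k , dim , e) =
  ≡.subst (HasDim S) (≡.sym (ℤ.+-injective (GroupProperties.∙-cancelʳ (record { isGroup = ℤ.+-0-isGroup }) (ℤ.- 1ℤ) (+ n) (+ k) e))) dim

module _ {F K : Field} (φ : FieldExtension F K) {q N : ℕ}
         (orderF : HasOrder F q) (orderK : HasOrder K N)
         (R : VectorSpace K) {r : ℕ} (dimR : HasDim (whole R) r) where

  private
    module F = Field F
    module K = Field K
    module φ = FieldExtension φ
    module FF = FiniteField F orderF
    module FK = FiniteField K orderK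
    module PK = Points FK._≈?_ R
  open VectorSpace R
  open Combinations R
  open Reduction φ orderF orderK R
  private module Rq = Combinations Rq

  finiteR : Finite (N ^ r) ≈ᴹ-setoid
  finiteR = Basis.finite dimR orderK

  private
    module EF = Enumeration orderF
    module EK = Enumeration orderK
    module ER = Enumeration finiteR
    module TK = Functions orderK
    module TR = Functions finiteR

  -- Every law after the two congruences is decidable by enumeration. Surjectivity of σ and g
  -- follows from finiteness, and for independent families b and b′ equality of g(⟨b⟩) with ⟨b′⟩
  -- over F follows from `carries` by counting dimensions. `preserves` makes g semilinear over F
  -- too, as a collineation of PG(rt-1,q) demands.
  record IsTransporter {n} (σ : K.Carrier → K.Carrier) (g : Carrierᴹ → Carrierᴹ)
                       (b b′ : Fin n → Carrierᴹ) : Set where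
    field
      σ-cong      : ∀ {x y} → x K.≈ y → σ x K.≈ σ y
      g-cong      : ∀ {u v} → u ≈ᴹ v → g u ≈ᴹ g v
      σ-+         : ∀ x y → σ (x K.+ y) K.≈ σ x K.+ σ y
      σ-*         : ∀ x y → σ (x K.* y) K.≈ σ x K.* σ y
      σ-1         : σ K.1# K.≈ K.1#
      σ-injective : ∀ x y → σ x K.≈ σ y → x K.≈ y
      g-+         : ∀ u v → g (u +ᴹ v) ≈ᴹ g u +ᴹ g v
      g-*         : ∀ a v → g (a *ₗ v) ≈ᴹ σ a *ₗ g v
      g-injective : ∀ u v → g u ≈ᴹ g v → u ≈ᴹ v
      preserves   : ∀ a → ∃[ a′ ] σ (φ.embed a) K.≈ φ.embed a′
      carries     : ∀ i → Rq.InSpan b′ (g (b i))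

  module _ {n} {b b′ : Fin n → Carrierᴹ} where

    isTransporter? : ∀ σ g → (∀ {x y} → x K.≈ y → σ x K.≈ σ y) → (∀ {u v} → u ≈ᴹ v → g u ≈ᴹ g v) →
                     Dec (IsTransporter σ g b b′)
    isTransporter? σ g σ-cong g-cong = map′
      (λ (a₁ , a₂ , a₃ , a₄ , a₅ , a₆ , a₇ , a₈ , a₉) → record
        { σ-cong = σ-cong ; g-cong = g-cong ; σ-+ = a₁ ; σ-* = a₂ ; σ-1 = a₃ ; σ-injective = a₄
        ; g-+ = a₅ ; g-* = a₆ ; g-injective = a₇ ; preserves = a₈ ; carries = a₉ })
      (λ t → let open IsTransporter t in
        σ-+ , σ-* , σ-1 , σ-injective , g-+ , g-* , g-injective , preserves , carries)
      (equal? orderK orderK orderK _ _ (λ e e′ → σ-cong (K.+-cong e e′)) (λ e e′ → K.+-cong (σ-cong e) (σ-cong e′))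
      ×-dec equal? orderK orderK orderK _ _ (λ e e′ → σ-cong (K.*-cong e e′)) (λ e e′ → K.*-cong (σ-cong e) (σ-cong e′))
      ×-dec (σ K.1# FK.≈? K.1#)
      ×-dec TK.injective? σ σ-cong
      ×-dec equal? finiteR finiteR finiteR _ _ (λ e e′ → g-cong (+ᴹ-cong e e′)) (λ e e′ → +ᴹ-cong (g-cong e) (g-cong e′))
      ×-dec equal? orderK finiteR finiteR _ _ (λ e e′ → g-cong (*ₗ-cong e e′)) (λ e e′ → *ₗ-cong (σ-cong e) (g-cong e′))
      ×-dec TR.injective? g g-cong
      ×-dec EF.all (λ a≈b (a′ , e) → a′ , K.trans (σ-cong (φ.⟦⟧-cong (F.sym a≈b))) e)
              (λ a → EF.any (λ a≈b e → K.trans e (φ.⟦⟧-cong a≈b)) (λ a′ → σ (φ.embed a) FK.≈? φ.embed a′))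
      ×-dec Fin.all? (λ i → FF.inSpan? Rq ER._≈?_ b′ (g (b i))))

    -- An arbitrary transporter agrees pointwise with a tabulated one; the search over tables is
    -- exhaustive because the laws pass to the tabulated one.
    isTransporter-resp : ∀ {σ σ′ g g′} → (∀ x → σ x K.≈ σ′ x) → (∀ v → g v ≈ᴹ g′ v) →
                         (∀ {x y} → x K.≈ y → σ x K.≈ σ y) → (∀ {u v} → u ≈ᴹ v → g u ≈ᴹ g v) →
                         IsTransporter σ′ g′ b b′ → IsTransporter σ g b b′
    isTransporter-resp s e σ-cong g-cong t = record
      { σ-cong      = σ-cong
      ; g-cong      = g-cong
      ; σ-+         = λ x y → K.trans (s _) (K.trans (σ-+ x y) (K.sym (K.+-cong (s x) (s y))))
      ; σ-*         = λ x y → K.trans (s _) (K.trans (σ-* x y) (K.sym (K.*-cong (s x) (s y))))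
      ; σ-1         = K.trans (s _) σ-1
      ; σ-injective = λ x y h → σ-injective x y (K.trans (K.sym (s x)) (K.trans h (s y)))
      ; g-+         = λ u v → ≈ᴹ-trans (e _) (≈ᴹ-trans (g-+ u v) (≈ᴹ-sym (+ᴹ-cong (e u) (e v))))
      ; g-*         = λ a v → ≈ᴹ-trans (e _) (≈ᴹ-trans (g-* a v) (≈ᴹ-sym (*ₗ-cong (s a) (e v))))
      ; g-injective = λ u v h → g-injective u v (≈ᴹ-trans (≈ᴹ-sym (e u)) (≈ᴹ-trans h (e v)))
      ; preserves   = λ a → let a′ , h = preserves a in a′ , K.trans (s _) h
      ; carries     = λ i → let c , h = carries i in c , ≈ᴹ-trans (e _) h
      }
      where open IsTransporter t using (σ-+; σ-*; σ-1; σ-injective; g-+; g-*; g-injective; preserves; carries)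

  Transportable : ∀ {n} (b b′ : Fin n → Carrierᴹ) → Set
  Transportable b b′ = ∃₂ λ σ g → IsTransporter σ g b b′

  transportable? : ∀ {n} (b b′ : Fin n → Carrierᴹ) → Dec (Transportable b b′)
  transportable? b b′ = map′
    (λ (i , j , t) → TK.table i , TR.table j , t)
    (λ (σ , g , t) → let open IsTransporter t
                         i , s = TK.tabulate σ σ-cong
                         j , e = TR.tabulate g g-cong
                     in i , j , isTransporter-resp s e (TK.table-cong i) (TR.table-cong j) t)
    (Fin.any? λ i → Fin.any? λ j →
      isTransporter? (TK.table i) (TR.table j) (TK.table-cong i) (TR.table-cong j))

  -- The vector form of `𝓑 U ⊆ 𝓑 U′`. Points are predicates and cannot be enumerated, whereas
  -- vectors of R can, so this form is decidable for spans.
  Dominated : Subspace Rq 0ℓ → Subspace Rq 0ℓ → Set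
  Dominated U U′ = ∀ u → u ∈ vectors U → u ≉ᴹ 0ᴹ → ∃[ a ] ¬ a K.≈ K.0# × a *ₗ u ∈ vectors U′

  𝓑⊆⇒Dominated : ∀ {U U′} → 𝓑 φ R U ⊆ 𝓑 φ R U′ → Dominated U U′
  𝓑⊆⇒Dominated {U} {U′} U⊆U′ u u∈U u≉0 =
    let v , (a , v≈au) , v∈U′ , v≉0 = ∈𝓑⇒ U′ {PK.point u u≉0}
          (U⊆U′ {PK.point u u≉0} (∈𝓑⇐ U {PK.point u u≉0} (u , PK.∈-line u , u∈U , u≉0)))
    in a , (λ a≈0 → v≉0 (≈ᴹ-trans v≈au (≈ᴹ-trans (*ₗ-congʳ a≈0) (*ₗ-zeroˡ u))))
         , Subspace.resp U′ v≈au v∈U′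

  Dominated⇒𝓑⊆ : ∀ {U U′} → Dominated U U′ → 𝓑 φ R U ⊆ 𝓑 φ R U′
  Dominated⇒𝓑⊆ {U} {U′} dom {P} P∈ =
    let u , u∈P , u∈U , u≉0 = ∈𝓑⇒ U {P} P∈
        a , a≉0 , au∈U′ = dom u u∈U u≉0
    in ∈𝓑⇐ U′ {P} (a *ₗ u , Subspace.*∈ (Point.subspace P) a u∈P , au∈U′ , scale≉0 a≉0 u≉0)

  dominated? : ∀ {k m} (b : Fin k → Carrierᴹ) (s : Fin m → Carrierᴹ) →
               Dec (Dominated (Rq.linearSpan b) (Rq.linearSpan s))
  dominated? b s = ER.all
    (λ u≈v h v∈ v≉0 → let a , a≉0 , au∈ = h (Subspace.resp (Rq.linearSpan b) (≈ᴹ-sym u≈v) v∈)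
                                             (λ u≈0 → v≉0 (≈ᴹ-trans (≈ᴹ-sym u≈v) u≈0))
                      in a , a≉0 , Subspace.resp (Rq.linearSpan s) (*ₗ-congˡ u≈v) au∈)
    (λ u → FF.inSpan? Rq ER._≈?_ b u →-dec (¬? (u ER.≈? 0ᴹ) →-dec
      EK.any (λ a≈b (a≉0 , au∈) → (λ b≈0 → a≉0 (K.trans a≈b b≈0))
                                , Subspace.resp (Rq.linearSpan s) (*ₗ-congʳ a≈b) au∈)
             (λ a → ¬? (a FK.≈? K.0#) ×-dec FF.inSpan? Rq ER._≈?_ s (a *ₗ u))))

  independent? : ∀ {k} (b : Fin k → Carrierᴹ) → Dec (Rq.Independent b)
  independent? {k} b = Enumeration.all (orderF ^ᶠ k)
    (λ c≋d h e i → F.trans (F.sym (c≋d i)) (h (≈ᴹ-trans (Rq.lincomb-congˡ b c≋d) e) i))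
    (λ c → (lincomb Rq c b ER.≈? 0ᴹ) →-dec Fin.all? (λ i → c i FF.≈? F.0#))

  -- Says that the F-spans of b and s meet the same spread elements. The comparison is with a basis
  -- s of one fixed subspace representing L because membership in L itself is not known to be
  -- decidable.
  Represents : ∀ {n} → (Fin n → Carrierᴹ) → (Fin n → Carrierᴹ) → Set
  Represents s b = Rq.Independent b × Dominated (Rq.linearSpan b) (Rq.linearSpan s)
                                    × Dominated (Rq.linearSpan s) (Rq.linearSpan b)

  represents? : ∀ {n} (s b : Fin n → Carrierᴹ) → Dec (Represents s b)
  represents? s b = independent? b ×-dec dominated? b s ×-dec dominated? s b

  -- Finiteness turns the injective σ and g into bijections. Since g sends the basis of U into U′
  -- and `preserves` keeps coefficients in F, g maps all of U into U′.
  transportable⇒moves : ∀ {n} {U U′ : Subspace Rq 0ℓ} (dimU : HasDim U n) (dimU′ : HasDim U′ n) →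
                        Transportable (HasDim.basis dimU) (HasDim.basis dimU′) →
                        ∃[ γ ] IsCollineation Rq γ × points U ^^ γ ≐ points U′ ×
                               Σ (PreservesSpread φ R γ) λ pr → IsCollineation R (PreservesSpread.inducedMap pr)
  transportable⇒moves {U = U} {U′} dimU dimU′ (σ , g , t) =
    Descent.moves h preserves U U′ dimU dimU′ λ v∈U →
      let c , v≈ = HasDim.spanning dimU v∈U in
      Subspace.resp U′ (≈ᴹ-sym (≈ᴹ-trans (g-cong v≈) (IsSemilinear.lincomb-homo semilinear _ (HasDim.basis dimU))))
        (lincomb∈-image c)
    where
    open IsTransporter t
    semilinear : IsSemilinear σ R R g
    semilinear = record { cong = g-cong ; +-homo = g-+ ; *-homo = g-* }
    h : SemilinearAutomorphism R
    h = semilinearAutomorphism {K} {R} {σ}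
      (ringIsomorphism {K} σ σ-cong σ-+ σ-* σ-1 (λ {x} {y} → σ-injective x y)
        (Enumeration.injective⇒surjective orderK σ (λ {x} {y} → σ-injective x y)))
      {g} semilinear (λ {u} {v} → g-injective u v)
      (Enumeration.injective⇒surjective finiteR g (λ {u} {v} → g-injective u v))
    lincomb∈-image : ∀ c → lincomb R (λ i → σ (φ.embed (c i))) (g ∘ HasDim.basis dimU) ∈ vectors U′
    lincomb∈-image c = Subspace.resp U′
      (lincomb-congˡ (g ∘ HasDim.basis dimU) (λ i → K.sym (proj₂ (preserves (c i)))))
      (Rq.lincomb∈ U′ (λ i → proj₁ (preserves (c i))) λ i → let d , e = carries i in
        Subspace.resp U′ (≈ᴹ-sym e) (Rq.lincomb∈ U′ d (HasDim.basis∈ dimU′)))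

  -- The search meets a basis only through its enumerated representative, which is equal to it
  -- merely up to `≈ᴹ`.
  changeBasis : ∀ {n} {U : Subspace Rq 0ℓ} (dimU : HasDim U n) (b : Fin n → Carrierᴹ) →
                (∀ i → b i ≈ᴹ HasDim.basis dimU i) → HasDim U n
  changeBasis {U = U} dimU b b≋ = record
    { basis       = b
    ; basis∈      = λ i → Subspace.resp U (≈ᴹ-sym (b≋ i)) (U.basis∈ i)
    ; independent = λ c h → U.independent c (≈ᴹ-trans (≈ᴹ-sym (Rq.lincomb-congʳ c b≋)) h)
    ; spanning    = λ v∈U → let c , e = U.spanning v∈U in c , ≈ᴹ-trans e (≈ᴹ-sym (Rq.lincomb-congʳ c b≋))
    }
    where module U = HasDim dimU

  -- Only finitely many pairs of bases have to be inspected, and transportability is decidable,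
  -- so the failure of condition (A) produces an explicit pair.
  untransportablePair : ∀ {n} {L : PointSet R} {S : Subspace Rq 0ℓ} (dimS : HasDim S n) → L ≐ 𝓑 φ R S →
                        ¬ ConditionA φ R L n →
                        ∃₂ λ b b′ → Represents (HasDim.basis dimS) b × Represents (HasDim.basis dimS) b′ ×
                                    ¬ Transportable b b′
  untransportablePair {n} {L} {S} dimS (L⊆S , S⊆L) ¬A = decide
    (Fin.any? λ i → Fin.any? λ j →
      represents? s (E.enum i) ×-dec represents? s (E.enum j) ×-dec ¬? (transportable? (E.enum i) (E.enum j)))
    where
    module E = Enumeration (finiteR ^ᶠ n)
    module S = HasDim dimS
    s = S.basis
    represents : ∀ {U} (dimU : HasDim U n) → 𝓑 φ R U ⊆ 𝓑 φ R S → 𝓑 φ R S ⊆ 𝓑 φ R U →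
                 Represents s (HasDim.basis dimU)
    represents {U} dimU U⊆S S⊆U =
        U.independent
      , (λ u (c , e) u≉0 → let a , a≉0 , au∈ = 𝓑⊆⇒Dominated {U} {S} (λ {P} → U⊆S {P}) u
                                                (Subspace.resp U (≈ᴹ-sym e) (Rq.lincomb∈ U c U.basis∈)) u≉0
                           in a , a≉0 , S.spanning au∈)
      , (λ u (c , e) u≉0 → let a , a≉0 , au∈ = 𝓑⊆⇒Dominated {S} {U} (λ {P} → S⊆U {P}) u
                                                (Subspace.resp S (≈ᴹ-sym e) (Rq.lincomb∈ S c S.basis∈)) u≉0
                           in a , a≉0 , U.spanning au∈)
      where module U = HasDim dimU
    decide : Dec _ → _
    decide (yes (i , j , rep , rep′ , ¬t)) = E.enum i , E.enum j , rep , rep′ , ¬t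
    decide (no none) = contradiction conditionA ¬A
      where
      conditionA : ConditionA φ R L n
      conditionA U U′ pdU pdU′ (U⊆L , L⊆U) (L⊆U′ , U′⊆L) =
        transportable⇒moves dimŨ dimŨ′
          -- `none` refutes only the non-transportability of this pair; decidability turns the
          -- double negation into an actual transporter.
          (decidable-stable (transportable? (HasDim.basis dimŨ) (HasDim.basis dimŨ′)) λ ¬t →
            none (_ , _ , represents dimŨ  (λ {P} x → L⊆S {P} (U⊆L {P} x)) (λ {P} x → L⊆U {P} (S⊆L {P} x))
                        , represents dimŨ′ (λ {P} x → L⊆S {P} (U′⊆L {P} x)) (λ {P} x → L⊆U′ {P} (S⊆L {P} x))
                        , ¬t))
        where
        enumerated : ∀ {U} → HasDim U n → HasDim U n
        enumerated dimU = changeBasis dimU _ (E.strictlyInverseˡ (HasDim.basis dimU))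
        dimŨ : HasDim U n
        dimŨ = enumerated (projDim⇒dim pdU)
        dimŨ′ : HasDim U′ n
        dimŨ′ = enumerated (projDim⇒dim pdU′)

embedding-isLinear : {K : Field} {R V : VectorSpace K} (ι : Embedding R V) → IsLinear R V (Embedding.embed ι)
embedding-isLinear ι = record { cong = ⟦⟧-cong ; +-homo = +ᴹ-homo ; *-homo = *ₗ-homo }
  where open Embedding ι

-- The centre Γ, the projection p, and subgeometries lying over given bases of R

module Construction
  {F K : Field} (φ : FieldExtension F K) {q N : ℕ} (orderF : HasOrder F q) (orderK : HasOrder K N)
  (R : VectorSpace K) {r : ℕ} (dimR : HasDim (whole R) r)
  (V : VectorSpace K) {n : ℕ} (dimV : HasDim (whole V) n) (ι : Embedding R V) where

  private
    module F = Field F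
    module K = Field K
    module φ = FieldExtension φ
    module FK = FiniteField K orderK
    module R = VectorSpace R
    module BR = Basis dimR
    module BV = Basis dimV
    module CR = Combinations R
    module PR = Points FK._≈?_ R
    module PV = Points FK._≈?_ V
    module EV = Enumeration (BV.finite orderK)
    module Reduction-R = Reduction φ orderF orderK R
    module CRq = Combinations (restrictScalars φ R)
    module ι = Embedding ι
    module ιL = IsSemilinear (embedding-isLinear ι)
  open VectorSpace V
  open Combinations V

  Vq : VectorSpace F
  Vq = restrictScalars φ V

  private module CVq = Combinations Vq

  Λ : Subspace V 0ℓ
  Λ = ι.range

  spanning⇒hasDim : ∀ {k} {x : Fin k → Carrierᴹ} → Independent x → (∀ i → InSpan x (BV.basis i)) →
                    HasDim (whole V) k
  spanning⇒hasDim {x = x} indep spans = record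
    { basis       = x
    ; basis∈      = λ _ → tt
    ; independent = indep
    ; spanning    = λ {v} _ → Subspace.resp (linearSpan x) (≈ᴹ-sym (BV.coord-spec v))
                                (lincomb∈ (linearSpan x) (BV.coord v) spans)
    }

  dim-unique : ∀ {k} → HasDim (whole V) k → k ≡ n
  dim-unique dim = ℕ.≤-antisym
    (FK.independent⇒≤ V (HasDim.independent dim) (λ c → BV.spanning tt))
    (FK.independent⇒≤ V BV.independent (λ c → HasDim.spanning dim tt))

  ιρ : Fin r → Carrierᴹ
  ιρ = ι.embed ∘ BR.basis

  ιρ-independent : Independent ιρ
  ιρ-independent c h = BR.independent c (ι.injective
    (≈ᴹ-trans (ιL.lincomb-homo c BR.basis) (≈ᴹ-trans h (≈ᴹ-sym ιL.0-homo))))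

  private module E = FK.Extension (FK.extendIndependent V EV._≈?_ ιρ-independent BV.basis)

  m : ℕ
  m = E.size

  complement : Fin m → Carrierᴹ
  complement = E.added

  adapted : HasDim (whole V) (m ℕ.+ r)
  adapted = spanning⇒hasDim E.independent E.spanning

  m+r≡n : m ℕ.+ r ≡ n
  m+r≡n = dim-unique adapted

  private module BA = Basis adapted

  -- The projection from Γ onto Λ, read in R through ι. Taking Γ to be the kernel of p makes
  -- membership in Γ an equation, and `p∘ι` makes p a left inverse of ι.
  p : Carrierᴹ → R.Carrierᴹ
  p = BA.extend R ((λ _ → R.0ᴹ) ++ BR.basis)

  p-isLinear : IsLinear V R p
  p-isLinear = BA.extend-isLinear R ((λ _ → R.0ᴹ) ++ BR.basis)

  module p = IsSemilinear p-isLinear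

  p-complement : ∀ j → p (complement j) R.≈ᴹ R.0ᴹ
  p-complement j = R.≈ᴹ-trans
    (p.cong (≈ᴹ-reflexive (≡.sym (≡.cong [ complement , ιρ ]′ (Fin.splitAt-↑ˡ m j r)))))
    (R.≈ᴹ-trans (BA.extend-basis R _ (j ↑ˡ r))
                (R.≈ᴹ-reflexive (≡.cong [ (λ _ → R.0ᴹ) , BR.basis ]′ (Fin.splitAt-↑ˡ m j r))))

  p-ιρ : ∀ k → p (ιρ k) R.≈ᴹ BR.basis k
  p-ιρ k = R.≈ᴹ-trans
    (p.cong (≈ᴹ-reflexive (≡.sym (≡.cong [ complement , ιρ ]′ (Fin.splitAt-↑ʳ m r k)))))
    (R.≈ᴹ-trans (BA.extend-basis R _ (m ↑ʳ k))
                (R.≈ᴹ-reflexive (≡.cong [ (λ _ → R.0ᴹ) , BR.basis ]′ (Fin.splitAt-↑ʳ m r k))))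

  p∘ι : ∀ x → p (ι.embed x) R.≈ᴹ x
  p∘ι = BR.linear-≗ R (∘-isSemilinear p-isLinear (embedding-isLinear ι))
          (record { cong = id ; +-homo = λ _ _ → R.≈ᴹ-refl ; *-homo = λ _ _ → R.≈ᴹ-refl }) p-ιρ

  Γ : Subspace V 0ℓ
  Γ = record
    { vectors = λ v → p v R.≈ᴹ R.0ᴹ
    ; resp    = λ u≈v pu≈0 → R.≈ᴹ-trans (p.cong (≈ᴹ-sym u≈v)) pu≈0
    ; 0∈      = p.0-homo
    ; +∈      = λ pu≈0 pv≈0 → R.≈ᴹ-trans (p.+-homo _ _) (R.≈ᴹ-trans (R.+ᴹ-cong pu≈0 pv≈0) (R.+ᴹ-identityˡ _))
    ; *∈      = λ a pv≈0 → R.≈ᴹ-trans (p.*-homo a _) (R.≈ᴹ-trans (R.*ₗ-congˡ pv≈0) (R.*ₗ-zeroʳ a))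
    }

  p-pair : ∀ c d → p (lincomb V c complement +ᴹ lincomb V d ιρ) R.≈ᴹ lincomb R d BR.basis
  p-pair c d = R.≈ᴹ-trans (p.+-homo _ _) (R.≈ᴹ-trans (R.+ᴹ-cong
    (lincomb∈ Γ c p-complement)
    (R.≈ᴹ-trans (p.lincomb-homo d ιρ) (CR.lincomb-congʳ d p-ιρ))) (R.+ᴹ-identityˡ _))

  dimΓ : HasDim Γ m
  dimΓ = record
    { basis       = complement
    ; basis∈      = p-complement
    ; independent = λ c h → proj₁ (lincomb-++-≈0 E.independent c (λ _ → K.0#)
                      (≈ᴹ-trans (+ᴹ-cong h (lincomb-0 ιρ)) (+ᴹ-identityˡ _)))
    ; spanning    = λ {v} pv≈0 →
        let c = BA.coord v
            v≈ = ≈ᴹ-trans (BA.coord-spec v) (lincomb-++ c complement ιρ)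
            d≈0 = BR.independent _ (R.≈ᴹ-trans (R.≈ᴹ-sym (p-pair (c ∘ (_↑ˡ r)) (c ∘ (m ↑ʳ_))))
                    (R.≈ᴹ-trans (p.cong (≈ᴹ-sym v≈)) pv≈0))
        in c ∘ (_↑ˡ r) , ≈ᴹ-trans v≈ (≈ᴹ-trans (+ᴹ-congˡ
             (≈ᴹ-trans (lincomb-congˡ ιρ d≈0) (lincomb-0 ιρ))) (+ᴹ-identityʳ _))
    }

  Γ-disjoint-Λ : Disjoint (points Γ) (points Λ)
  Γ-disjoint-Λ P P⊆Γ P⊆Λ =
    let v , v∈P , v≉0 = PV.generator P
        x , _ , ιx≈v = P⊆Λ v∈P
        x≈0 = R.≈ᴹ-trans (R.≈ᴹ-sym (p∘ι x)) (R.≈ᴹ-trans (p.cong ιx≈v) (P⊆Γ v∈P))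
    in v≉0 (≈ᴹ-trans (≈ᴹ-sym ιx≈v) (≈ᴹ-trans (ιL.cong x≈0) ιL.0-homo))

  -- Independence is over K, so that the F-span of w is a canonical subgeometry, although b itself
  -- is in general dependent over K.
  record LiftedBasis (b : Fin n → R.Carrierᴹ) : Set where
    field
      w           : Fin n → Carrierᴹ
      independent : Independent w
      lifts       : ∀ i → p (w i) R.≈ᴹ b i

  -- The map π sending the basis of V to b becomes p after an automorphism Θ of V: both have a kernel
  -- with a complement on which they restrict to a bijection onto R.
  liftBasis : ∀ b → (∀ v → CR.InSpan b v) → LiftedBasis b
  liftBasis b spans = construct E′.size E′.added
      (ℕ.+-cancelʳ-≡ r E′.size m (≡.trans (dim-unique dim′) (≡.sym m+r≡n)))
      E′.independent (HasDim.spanning dim′ ∘ (λ _ → tt))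
      (λ j → let i , e = E′.added∈ j in R.≈ᴹ-trans (π.cong (≈ᴹ-reflexive e)) (π-e′ i))
    where
    π : Carrierᴹ → R.Carrierᴹ
    π = BV.extend R b
    π-isLinear : IsLinear V R π
    π-isLinear = BV.extend-isLinear R b
    module π = IsSemilinear π-isLinear

    -- Preimages under π of the basis of R, found by expressing that basis in b; they span a
    -- complement of the kernel of π.
    y : Fin r → Carrierᴹ
    y k = lincomb V (proj₁ (spans (BR.basis k))) BV.basis

    π-y : ∀ k → π (y k) R.≈ᴹ BR.basis k
    π-y k = R.≈ᴹ-trans (π.lincomb-homo _ BV.basis)
      (R.≈ᴹ-trans (CR.lincomb-congʳ _ (BV.extend-basis R b)) (R.≈ᴹ-sym (proj₂ (spans (BR.basis k)))))

    π-lincomb-y : ∀ c → π (lincomb V c y) R.≈ᴹ lincomb R c BR.basis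
    π-lincomb-y c = R.≈ᴹ-trans (π.lincomb-homo c y) (CR.lincomb-congʳ c π-y)

    y-independent : Independent y
    y-independent c h = BR.independent c
      (R.≈ᴹ-trans (R.≈ᴹ-sym (π-lincomb-y c)) (R.≈ᴹ-trans (π.cong h) π.0-homo))

    correction : Fin n → Carrierᴹ
    correction i = lincomb V (BR.coord (π (BV.basis i))) y

    -- Subtracting the vector of the y-span with the same image moves each basis vector into the
    -- kernel of π; together with y these still span V, so extending y by some of them yields a
    -- basis of V.
    e′ : Fin n → Carrierᴹ
    e′ i = BV.basis i +ᴹ (K.- K.1#) *ₗ correction i

    π-e′ : ∀ i → π (e′ i) R.≈ᴹ R.0ᴹ
    π-e′ i = R.≈ᴹ-trans (π.+-homo _ _) (R.≈ᴹ-trans (R.+ᴹ-congˡ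
      (R.≈ᴹ-trans (π.*-homo _ _) (R.*ₗ-congˡ
        (R.≈ᴹ-trans (π-lincomb-y _) (R.≈ᴹ-sym (BR.coord-spec (π (BV.basis i))))))))
      (CR.v+-1v≈0 (π (BV.basis i))))

    module E′ = FK.Extension (FK.extendIndependent V EV._≈?_ y-independent e′)

    correction∈ : ∀ i → InSpan (E′.added ++ y) (correction i)
    correction∈ i = lincomb∈ (linearSpan (E′.added ++ y)) (BR.coord (π (BV.basis i))) λ k →
      unitVector K (E′.size ↑ʳ k) , ≈ᴹ-sym (≈ᴹ-trans (lincomb-unit (E′.size ↑ʳ k) (E′.added ++ y))
        (≈ᴹ-reflexive (≡.cong [ E′.added , y ]′ (Fin.splitAt-↑ʳ E′.size r k))))

    basis∈ : ∀ i → InSpan (E′.added ++ y) (BV.basis i)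
    basis∈ i = Subspace.resp S
        (≈ᴹ-trans (+ᴹ-assoc _ _ _) (≈ᴹ-trans (+ᴹ-congˡ
          (≈ᴹ-trans (+ᴹ-comm _ _) (v+-1v≈0 (correction i)))) (+ᴹ-identityʳ _)))
        (Subspace.+∈ S (E′.spanning i) (correction∈ i))
      where S = linearSpan (E′.added ++ y)

    dim′ : HasDim (whole V) (E′.size ℕ.+ r)
    dim′ = spanning⇒hasDim E′.independent basis∈

    -- The length of z is a variable here so that `m′ ≡ m` can be matched on. Then `z ++ y` is
    -- indexed like the adapted basis, and Θ sends kernel part to kernel part and section to
    -- section.
    construct : ∀ m′ (z : Fin m′ → Carrierᴹ) → m′ ≡ m → Independent (z ++ y) →
                (∀ v → InSpan (z ++ y) v) → (∀ j → π (z j) R.≈ᴹ R.0ᴹ) → LiftedBasis b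
    construct _ z ≡.refl indep spans′ π-z = record
      { w           = λ i → Θ (BV.basis i)
      ; independent = λ c h → BV.independent c (Θ-kernel _ (≈ᴹ-trans (Θ.lincomb-homo c BV.basis) h))
      ; lifts       = λ i → R.≈ᴹ-trans (p∘Θ (BV.basis i)) (BV.extend-basis R b i)
      }
      where
      dim : HasDim (whole V) (m ℕ.+ r)
      dim = record { basis = z ++ y ; basis∈ = λ _ → tt ; independent = indep ; spanning = λ {v} _ → spans′ v }
      module B = Basis dim
      Θ : Carrierᴹ → Carrierᴹ
      Θ = B.extend V BA.basis
      module Θ = IsSemilinear (B.extend-isLinear V BA.basis)
      Θ-kernel : ∀ v → Θ v ≈ᴹ 0ᴹ → v ≈ᴹ 0ᴹ
      Θ-kernel v h = ≈ᴹ-trans (B.coord-spec v)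
        (≈ᴹ-trans (lincomb-congˡ (z ++ y) (BA.independent (B.coord v) h)) (lincomb-0 (z ++ y)))
      on-basis : ∀ i → p (Θ ((z ++ y) i)) R.≈ᴹ π ((z ++ y) i)
      on-basis i = R.≈ᴹ-trans (p.cong (B.extend-basis V BA.basis i)) (compare (splitAt m i))
        where
        compare : ∀ s → p ([ complement , ιρ ]′ s) R.≈ᴹ π ([ z , y ]′ s)
        compare (inj₁ j) = R.≈ᴹ-trans (p-complement j) (R.≈ᴹ-sym (π-z j))
        compare (inj₂ k) = R.≈ᴹ-trans (p-ιρ k) (R.≈ᴹ-sym (π-y k))
      p∘Θ : ∀ v → p (Θ v) R.≈ᴹ π v
      p∘Θ = B.linear-≗ R (∘-isSemilinear p-isLinear (B.extend-isLinear V BA.basis)) π-isLinear on-basis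

  -- With Q spanned by u, the subspace p⁻¹(P) contains Γ and Q, which gives one inclusion.
  -- Conversely x in P is some a p(u), so ι(x) - a u lies in Γ and ι(x) in the join.
  join-∩-Λ : ∀ {u} (P : Point R) → p u ∈ pvectors P → p u R.≉ᴹ R.0ᴹ →
             ∀ (Q : Point V) → pvectors Q ≐ Span V (_≈ᴹ u) →
             vectors (Γ ∨ Q) ∩ vectors Λ ≐ image _≈ᴹ_ ι.embed (pvectors P)
  join-∩-Λ {u} P pu∈P pu≉0 Q (Q⊆u , u⊆Q) = to , from
    where
    module P = Subspace (Point.subspace P)
    p⁻¹P : Subspace V 0ℓ
    p⁻¹P = record
      { vectors = λ v → p v ∈ pvectors P
      ; resp    = λ e → P.resp (p.cong e)
      ; 0∈      = P.resp (R.≈ᴹ-sym p.0-homo) P.0∈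
      ; +∈      = λ x y → P.resp (R.≈ᴹ-sym (p.+-homo _ _)) (P.+∈ x y)
      ; *∈      = λ a x → P.resp (R.≈ᴹ-sym (p.*-homo a _)) (P.*∈ a x)
      }
    Γ∨Q⊆ : vectors (Γ ∨ Q) ⊆ vectors p⁻¹P
    Γ∨Q⊆ = Span⊆ p⁻¹P λ
      { (inj₁ pv≈0) → P.resp (R.≈ᴹ-sym pv≈0) P.0∈
      ; (inj₂ v∈Q)  → Span⊆ p⁻¹P (λ v≈u → P.resp (p.cong (≈ᴹ-sym v≈u)) pu∈P) (Q⊆u v∈Q) }
    to : vectors (Γ ∨ Q) ∩ vectors Λ ⊆ image _≈ᴹ_ ι.embed (pvectors P)
    to (v∈ , (x , _ , ιx≈v)) =
      x , P.resp (R.≈ᴹ-trans (p.cong (≈ᴹ-sym ιx≈v)) (p∘ι x)) (Γ∨Q⊆ v∈) , ιx≈v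
    from : image _≈ᴹ_ ι.embed (pvectors P) ⊆ vectors (Γ ∨ Q) ∩ vectors Λ
    from {v} (x , x∈P , ιx≈v) = v∈join , (x , tt , ιx≈v)
      where
      a = proj₁ (PR.generates P pu∈P pu≉0 x∈P)
      x≈apu = proj₂ (PR.generates P pu∈P pu≉0 x∈P)
      v-au : Carrierᴹ
      v-au = v +ᴹ (K.- K.1#) *ₗ (a *ₗ u)
      v-au∈Γ : v-au ∈ vectors Γ
      v-au∈Γ = R.≈ᴹ-trans (p.+-homo _ _) (R.≈ᴹ-trans (R.+ᴹ-cong
        (R.≈ᴹ-trans (p.cong (≈ᴹ-sym ιx≈v)) (p∘ι x))
        (R.≈ᴹ-trans (p.*-homo _ _) (R.*ₗ-congˡ (R.≈ᴹ-trans (p.*-homo a u) (R.≈ᴹ-sym x≈apu)))))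
        (CR.v+-1v≈0 x))
      v∈join : v ∈ vectors (Γ ∨ Q)
      v∈join = Span.eq (≈ᴹ-trans (+ᴹ-assoc _ _ _) (≈ᴹ-trans (+ᴹ-congˡ
                          (≈ᴹ-trans (+ᴹ-comm _ _) (v+-1v≈0 (a *ₗ u)))) (+ᴹ-identityʳ v)))
                 (Span.add (Span.gen (inj₁ v-au∈Γ))
                           (Span.gen (inj₂ (u⊆Q (Span.mul a (Span.gen ≈ᴹ-refl))))))

  module Subgeometry {b : Fin n → R.Carrierᴹ} (b-independent : CRq.Independent b)
                     (lifted : LiftedBasis b) where
    open LiftedBasis lifted

    W : Subspace Vq 0ℓ
    W = CVq.linearSpan w

    subgeometry : PointSet V
    subgeometry P = Lift (lsuc 0ℓ) (∃[ x ] x ∈ vectors W × x ≉ᴹ 0ᴹ × pvectors P ≐ Span V (_≈ᴹ x))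

    w-independentᶠ : CVq.Independent w
    w-independentᶠ c h i = φ.injective (K.trans (independent (φ.embed ∘ c) h i) (K.sym φ.0#-homo))

    point∈ : ∀ {x} → x ∈ vectors W → (x≉0 : x ≉ᴹ 0ᴹ) → PV.point x x≉0 ∈ subgeometry
    point∈ {x} x∈W x≉0 = lift (x , x∈W , x≉0 , PV.line≐Span x)

    isCanonical : IsCanonicalSubgeometry φ V subgeometry
    isCanonical = n , dimV , W , CVq.linearSpan-hasDim w-independentᶠ
      , ((λ _ → tt) , λ {v} _ →
           let c , v≈ = FK.independent⇒spanning V {S = whole V} dimV {w} (λ _ → tt) independent {v} tt
           in Span.eq (≈ᴹ-sym v≈) (lincomb∈ (span V (vectors W)) c
                (λ i → Span.gen (HasDim.basis∈ (CVq.linearSpan-hasDim w-independentᶠ) i))))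
      , lower , lift

    p-lincomb : ∀ c → p (lincomb Vq c w) R.≈ᴹ lincomb (restrictScalars φ R) c b
    p-lincomb c = R.≈ᴹ-trans (p.lincomb-homo (φ.embed ∘ c) w) (CR.lincomb-congʳ (φ.embed ∘ c) lifts)

    -- p sends the F-basis w of W to b, which is independent over F; so W meets the kernel Γ
    -- trivially, even when Γ is nonzero.
    p≉0 : ∀ {x} → x ∈ vectors W → x ≉ᴹ 0ᴹ → p x R.≉ᴹ R.0ᴹ
    p≉0 (c , x≈) x≉0 px≈0 = x≉0 (≈ᴹ-trans x≈ (≈ᴹ-trans (CVq.lincomb-congˡ w
      (b-independent c (R.≈ᴹ-trans (R.≈ᴹ-sym (p-lincomb c)) (R.≈ᴹ-trans (p.cong (≈ᴹ-sym x≈)) px≈0))))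
      (CVq.lincomb-0 w)))

    disjoint-Γ : Disjoint subgeometry (points Γ)
    disjoint-Γ P (lift (x , x∈W , x≉0 , _ , x⊆P)) P⊆Γ = p≉0 x∈W x≉0 (P⊆Γ (x⊆P (Span.gen ≈ᴹ-refl)))

    -- p maps W onto the F-span of b, so the points of its `𝓑` are exactly those spanned by p(x) for
    -- nonzero x in W, and `join-∩-Λ` recognises each of them as the projection of the point spanned
    -- by x.
    projects : ∀ {L : PointSet R} → L ≐ 𝓑 φ R (CRq.linearSpan b) →
               ι.imagePoints L ≐ projection Γ Λ subgeometry
    projects {L} (L⊆𝓑 , 𝓑⊆L) =
        (λ { {Q} (P , P∈L , Q⊆ , ⊆Q) →
           let u , u∈P , (c , u≈) , u≉0 = Reduction-R.∈𝓑⇒ (CRq.linearSpan b) {P} (L⊆𝓑 {P} P∈L)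
               x = lincomb Vq c w
               px≈u = R.≈ᴹ-trans (p-lincomb c) (R.≈ᴹ-sym u≈)
               px≉0 = λ px≈0 → u≉0 (R.≈ᴹ-trans (R.≈ᴹ-sym px≈u) px≈0)
               x≉0 = λ x≈0 → px≉0 (R.≈ᴹ-trans (p.cong x≈0) p.0-homo)
               to , from = join-∩-Λ P (Subspace.resp (Point.subspace P) (R.≈ᴹ-sym px≈u) u∈P) px≉0
                             (PV.point x x≉0) (PV.line≐Span x)
           in PV.point x x≉0 , point∈ (c , ≈ᴹ-refl) x≉0 , (λ v∈ → from (Q⊆ v∈)) , (λ v∈ → ⊆Q (to v∈)) })
      , (λ { {Q} (P′ , lift (x , x∈W , x≉0 , P′≐x) , Q⊆ , ⊆Q) →
           let px≉0 = p≉0 x∈W x≉0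
               P = PR.point (p x) px≉0
               c , x≈ = x∈W
               to , from = join-∩-Λ P (PR.∈-line (p x)) px≉0 P′ P′≐x
           in P , 𝓑⊆L {P} (Reduction-R.∈𝓑⇐ (CRq.linearSpan b) {P}
                    (p x , PR.∈-line (p x) , (c , R.≈ᴹ-trans (p.cong x≈) (p-lincomb c)) , px≉0))
                , (λ v∈ → to (Q⊆ v∈)) , (λ v∈ → ⊆Q (from v∈)) })

field-cancel : (K : Field) → let open Field K in ∀ {x y z} → x * y ≈ 1# → z * y ≈ 0# → z ≈ 0#
field-cancel K {x} {y} {z} xy≈1 zy≈0 =
  trans (sym (*-identityʳ z)) (trans (*-congˡ (sym (trans (*-comm y x) xy≈1)))
  (trans (sym (*-assoc z y x)) (trans (*-congʳ zy≈0) (zeroˡ x))))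
  where open Field K

*-isSemilinear : {K : Field} {V W : VectorSpace K} {σ : Field.Carrier K → Field.Carrier K} →
                 let open VectorSpace W in ∀ ν {f} → IsSemilinear σ V W f → IsSemilinear σ V W (λ v → ν *ₗ f v)
*-isSemilinear {K} {V} {W} {σ} ν {f} isSemilinear = record
  { cong   = λ e → *ₗ-congˡ (f.cong e)
  ; +-homo = λ u v → ≈ᴹ-trans (*ₗ-congˡ (f.+-homo u v)) (*ₗ-distribˡ ν _ _)
  ; *-homo = λ a v → ≈ᴹ-trans (*ₗ-congˡ (f.*-homo a v)) (≈ᴹ-trans (≈ᴹ-sym (*ₗ-assoc _ _ _))
               (≈ᴹ-trans (*ₗ-congʳ (K.*-comm ν (σ a))) (*ₗ-assoc _ _ _)))
  }
  where
  module K = Field K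
  module f = IsSemilinear isSemilinear
  open VectorSpace W

-- From a collineation fixing Γ and matching the subgeometries to a transporter

module Comparison
  {F K : Field} (φ : FieldExtension F K) {q N : ℕ} (orderF : HasOrder F q) (orderK : HasOrder K N)
  (R : VectorSpace K) {r : ℕ} (dimR : HasDim (whole R) r)
  (V : VectorSpace K) {n : ℕ} (dimV : HasDim (whole V) n) (ι : Embedding R V) where

  open Construction φ orderF orderK R dimR V dimV ι
  private
    module F = Field F
    module K = Field K
    module φ = FieldExtension φ
    module FF = FiniteField F orderF
    module FK = FiniteField K orderK
    module R = VectorSpace R
    module CR = Combinations R
    module CRq = Combinations (restrictScalars φ R)
    module PV = Points FK._≈?_ V
    module CVq = Combinations Vq
    module EV = Enumeration (Basis.finite dimV orderK)
    module ι = Embedding ι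
  open VectorSpace V
  open Combinations V

  module _ {β : Point V → Point V} (isColl : IsCollineation V β)
           (Γ^β≐Γ : points Γ ^^ β ≐ points Γ) where
    open IsCollineation isColl
    private module A = Automorphism semilinear
    open A using (f)

    -- The hypothesis on β speaks of points, that is, of nonzero vectors; the zero vector needs the
    -- separate case.
    f-Γ : ∀ {v} → v ∈ vectors Γ → f v ∈ vectors Γ
    f-Γ {v} v∈Γ = by-cases (v EV.≈? 0ᴹ)
      where
      by-cases : Dec (v ≈ᴹ 0ᴹ) → f v ∈ vectors Γ
      by-cases (yes v≈0) =
        Subspace.resp Γ (≈ᴹ-sym (≈ᴹ-trans (A.f-cong v≈0) (IsSemilinear.0-homo A.isSemilinear))) (Subspace.0∈ Γ)
      by-cases (no v≉0) = let P = PV.point v v≉0 in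
        proj₁ Γ^β≐Γ {β P} (P , (λ {x} → PV.line⊆ Γ v∈Γ {x}) , id , id)
          (proj₂ (isInduced P) (v , PV.∈-line v , ≈ᴹ-refl))

    -- The point spanned by f(v) lies in Γ, hence is the image of a point of Γ; injectivity of f
    -- places v in that point.
    f-Γ⁻¹ : ∀ {v} → f v ∈ vectors Γ → v ∈ vectors Γ
    f-Γ⁻¹ {v} fv∈Γ = by-cases (v EV.≈? 0ᴹ)
      where
      by-cases : Dec (v ≈ᴹ 0ᴹ) → v ∈ vectors Γ
      by-cases (yes v≈0) = Subspace.resp Γ (≈ᴹ-sym v≈0) (Subspace.0∈ Γ)
      by-cases (no v≉0) =
        let fv≉0 = A.f≉0 v≉0
            P , P⊆Γ , βP⊆ , ⊆βP = proj₂ Γ^β≐Γ {PV.point (f v) fv≉0} (λ {x} → PV.line⊆ Γ fv∈Γ {x})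
            x , x∈P , fx≈fv = proj₁ (isInduced P) (⊆βP (PV.∈-line (f v)))
        in Subspace.resp Γ (A.f-injective fx≈fv) (P⊆Γ x∈P)

    module _ {b b′ : Fin n → R.Carrierᴹ} (b-independent : CRq.Independent b) (b′-independent : CRq.Independent b′)
             (lifted : LiftedBasis b) (lifted′ : LiftedBasis b′) where
      private
        module S = Subgeometry b-independent lifted
        module S′ = Subgeometry b′-independent lifted′
        module L = LiftedBasis lifted

      module _ (S^β≐S′ : S.subgeometry ^^ β ≐ S′.subgeometry) where

        -- Matching of the subgeometries is a statement about points over K, so it places f(x) in W′
        -- only up to a factor that may depend on x.
        f-W : ∀ {x} → x ∈ vectors S.W → x ≉ᴹ 0ᴹ → ∃₂ λ a x′ → x′ ∈ vectors S′.W × f x ≈ᴹ a *ₗ x′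
        f-W {x} x∈W x≉0 =
          let P = PV.point x x≉0
              lift (x′ , x′∈W′ , _ , βP⊆x′ , _) = proj₁ S^β≐S′ {β P} (P , S.point∈ x∈W x≉0 , id , id)
              a , fx≈ = proj₂ (PV.line≐Span x′) (βP⊆x′ (proj₂ (isInduced P) (x , PV.∈-line x , ≈ᴹ-refl)))
          in a , x′ , x′∈W′ , fx≈

        -- Rescaling f so that the sum of the lifted basis lands in W′ makes f map W into W′: the image of
        -- the sum, expanded in W′, fixes the factors by which the images of the basis vectors leave W′.
        transportable : ∀ {k} → n ≡ ℕ.suc (ℕ.suc k) → Transportable φ orderF orderK R dimR b b′
        transportable n≡ = A.σ , g , record
          { σ-cong      = A.σ-cong
          ; g-cong      = g.cong
          ; σ-+         = A.σ-+
          ; σ-*         = A.σ-*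
          ; σ-1         = A.σ-1
          ; σ-injective = λ _ _ → A.σ-injective
          ; g-+         = g.+-homo
          ; g-*         = g.*-homo
          -- If g(x) = 0 then f sends ι(x) into Γ, so ι(x) lies in Γ, and p(ι(x)) = x vanishes.
          ; g-injective = λ _ _ → g.kernel-trivial⇒injective λ x gx≈0 →
              R.≈ᴹ-trans (R.≈ᴹ-sym (p∘ι x)) (f-Γ⁻¹ (f′-Γ⁻¹ gx≈0))
          ; preserves   = preserves n≡
          ; carries     = carries
          }
          where
          first : Fin n
          first = ≡.subst Fin (≡.sym n≡) zero

          ones : Fin n → F.Carrier
          ones _ = F.1#

          s : Carrierᴹ
          s = lincomb Vq ones L.w

          nonzero : ∀ c i → ¬ c i F.≈ F.0# → lincomb Vq c L.w ≉ᴹ 0ᴹ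
          nonzero c i cᵢ≉0 h = cᵢ≉0 (S.w-independentᶠ c h i)

          s≉0 : s ≉ᴹ 0ᴹ
          s≉0 = nonzero ones first F.1≉0

          fs = f-W (ones , ≈ᴹ-refl) s≉0
          μ = proj₁ fs
          s′ = proj₁ (proj₂ fs)
          s′∈W′ = proj₁ (proj₂ (proj₂ fs))
          fs≈μs′ = proj₂ (proj₂ (proj₂ fs))

          μ≉0 : ¬ μ K.≈ K.0#
          μ≉0 μ≈0 = A.f≉0 s≉0 (≈ᴹ-trans fs≈μs′ (≈ᴹ-trans (*ₗ-congʳ μ≈0) (*ₗ-zeroˡ s′)))

          ν = proj₁ (K.inverse μ μ≉0)
          μν≈1 = proj₂ (K.inverse μ μ≉0)

          f′ : Carrierᴹ → Carrierᴹ
          f′ v = ν *ₗ f v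
          f′-isSemilinear : IsSemilinear A.σ V V f′
          f′-isSemilinear = *-isSemilinear {V = V} {W = V} ν A.isSemilinear
          module f′ = IsSemilinear f′-isSemilinear

          f′-Γ⁻¹ : ∀ {v} → f′ v ∈ vectors Γ → f v ∈ vectors Γ
          f′-Γ⁻¹ f′v∈ = Subspace.resp Γ
            (≈ᴹ-trans (≈ᴹ-sym (*ₗ-assoc _ _ _)) (≈ᴹ-trans (*ₗ-congʳ μν≈1) (*ₗ-identityˡ _)))
            (Subspace.*∈ Γ μ f′v∈)

          p∘f′-isSemilinear : IsSemilinear A.σ V R (p ∘ f′)
          p∘f′-isSemilinear = ∘-isSemilinear p-isLinear f′-isSemilinear
          module p∘f′ = IsSemilinear p∘f′-isSemilinear

          g : R.Carrierᴹ → R.Carrierᴹ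
          g = p ∘ f′ ∘ ι.embed
          g-isSemilinear : IsSemilinear A.σ R R g
          g-isSemilinear = ∘-isSemilinear p∘f′-isSemilinear (embedding-isLinear ι)
          module g = IsSemilinear g-isSemilinear

          -- f preserves Γ, the kernel of p, so p ∘ f′ depends on a vector only through its image
          -- under p: f′ descends to R.
          p∘f′-factors : ∀ {u v} → p u R.≈ᴹ p v → p (f′ u) R.≈ᴹ p (f′ v)
          p∘f′-factors {u} {v} pu≈pv = CR.u+-1v≈0⇒u≈v
            (R.≈ᴹ-trans (R.+ᴹ-congˡ (R.≈ᴹ-trans (R.*ₗ-congʳ (K.sym σ-1)) (R.≈ᴹ-sym (p∘f′.*-homo _ v))))
            (R.≈ᴹ-trans (R.≈ᴹ-sym (p∘f′.+-homo _ _)) (Subspace.*∈ Γ ν (f-Γ difference∈Γ))))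
            where
            σ-1 : A.σ (K.- K.1#) K.≈ K.- K.1#
            σ-1 = K.trans (A.σ-neg _) (K.-‿cong A.σ-1)
            difference∈Γ : (u +ᴹ (K.- K.1#) *ₗ v) ∈ vectors Γ
            difference∈Γ = R.≈ᴹ-trans (p.+-homo _ _) (R.≈ᴹ-trans
              (R.+ᴹ-cong pu≈pv (p.*-homo _ v)) (CR.v+-1v≈0 (p v)))

          z : Fin n → Carrierᴹ
          z i = f′ (L.w i)

          ν≉0 : ¬ ν K.≈ K.0#
          ν≉0 ν≈0 = K.1≉0 (K.trans (K.sym μν≈1) (K.trans (K.*-congˡ ν≈0) (K.zeroʳ μ)))

          z-independent : Independent z
          z-independent = semilinear-independent f′-isSemilinear A.σ-surjective A.σ-cong A.σ-0
            (λ e → A.f-injective (scale-injective ν≉0 e)) L.independent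

          f′-W : ∀ {x} → x ∈ vectors S.W → x ≉ᴹ 0ᴹ → ∃₂ λ a x′ → x′ ∈ vectors S′.W × f′ x ≈ᴹ a *ₗ x′
          f′-W x∈W x≉0 = let a , x′ , x′∈W′ , e = f-W x∈W x≉0 in
            ν K.* a , x′ , x′∈W′ , ≈ᴹ-trans (*ₗ-congˡ e) (≈ᴹ-sym (*ₗ-assoc _ _ _))

          w≉0 : ∀ i → L.w i ≉ᴹ 0ᴹ
          w≉0 i h = K.1≉0 (K.trans (K.reflexive (≡.sym (unitVector-diagonal K i)))
            (L.independent (unitVector K i) (≈ᴹ-trans (lincomb-unit i L.w) h) i))

          zᵢ = λ i → f′-W (HasDim.basis∈ (CVq.linearSpan-hasDim S.w-independentᶠ) i) (w≉0 i)
          λᵢ = λ i → proj₁ (zᵢ i)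
          x′ = λ i → proj₁ (proj₂ (zᵢ i))
          x′∈W′ = λ i → proj₁ (proj₂ (proj₂ (zᵢ i)))
          z≈λx′ = λ i → proj₂ (proj₂ (proj₂ (zᵢ i)))

          λᵢ≉0 : ∀ i → ¬ λᵢ i K.≈ K.0#
          λᵢ≉0 i λ≈0 = scale≉0 ν≉0 (A.f≉0 (w≉0 i))
            (≈ᴹ-trans (z≈λx′ i) (≈ᴹ-trans (*ₗ-congʳ λ≈0) (*ₗ-zeroˡ (x′ i))))

          κ : Fin n → K.Carrier
          κ i = proj₁ (K.inverse (λᵢ i) (λᵢ≉0 i))
          λκ≈1 : ∀ i → λᵢ i K.* κ i K.≈ K.1#
          λκ≈1 i = proj₂ (K.inverse (λᵢ i) (λᵢ≉0 i))

          x′≈κz : ∀ i → x′ i ≈ᴹ κ i *ₗ z i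
          x′≈κz i = ≈ᴹ-trans (≈ᴹ-sym (inverse-scale (λκ≈1 i) (x′ i))) (*ₗ-congˡ (≈ᴹ-sym (z≈λx′ i)))

          lincomb-x′ : ∀ c → lincomb V c x′ ≈ᴹ lincomb V (λ i → c i K.* κ i) z
          lincomb-x′ c = ≈ᴹ-trans (lincomb-congʳ c x′≈κz) (lincomb-scaled c κ z)

          x′-independentᶠ : CVq.Independent x′
          x′-independentᶠ c h i = φ.injective (K.trans (field-cancel K (λκ≈1 i)
            (z-independent _ (≈ᴹ-trans (≈ᴹ-sym (lincomb-x′ (φ.embed ∘ c))) h) i)) (K.sym φ.0#-homo))

          dimW′ : HasDim S′.W n
          dimW′ = CVq.linearSpan-hasDim S′.w-independentᶠ

          -- The x′ are n vectors of W′ independent over F, so s′ is the sum of the `d i *ₗ x′ i`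
          -- with d in F. It is also f′(s), the sum of the `z i`. As `x′ i` is κ i times `z i`,
          -- comparing coefficients over K gives d i κ i = 1, that is, z i = d i x′ i.
          z∈W′ : ∀ i → z i ∈ vectors S′.W
          z∈W′ i = Subspace.resp S′.W (≈ᴹ-trans (*ₗ-congˡ (x′≈κz i))
              (≈ᴹ-trans (≈ᴹ-sym (*ₗ-assoc _ _ _)) (≈ᴹ-trans (*ₗ-congʳ (dκ≈1 i)) (*ₗ-identityˡ _))))
            (Subspace.*∈ S′.W (d i) (x′∈W′ i))
            where
            s′∈ : CVq.InSpan x′ s′
            s′∈ = FF.independent⇒spanning Vq {S = S′.W} dimW′ x′∈W′ x′-independentᶠ s′∈W′
            d = proj₁ s′∈
            s′≈f′s : s′ ≈ᴹ f′ s
            s′≈f′s = ≈ᴹ-trans (≈ᴹ-sym (inverse-scale μν≈1 s′)) (*ₗ-congˡ (≈ᴹ-sym fs≈μs′))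
            dκ≈1 : ∀ i → φ.embed (d i) K.* κ i K.≈ K.1#
            dκ≈1 i = K.trans (independent⇒unique z-independent (≈ᴹ-trans (≈ᴹ-sym (lincomb-x′ (φ.embed ∘ d)))
              (≈ᴹ-trans (≈ᴹ-sym (proj₂ s′∈)) (≈ᴹ-trans s′≈f′s (f′.lincomb-homo _ L.w)))) i)
              (K.trans (A.σ-cong φ.1#-homo) A.σ-1)

          carries : ∀ i → CRq.InSpan b′ (g (b i))
          carries i = let c , e = z∈W′ i in c ,
            -- ι(b i) and the lifted w i have the same image b i under p, so f′ may be evaluated at
            -- w i instead, where its value z i lies in W′.
            R.≈ᴹ-trans (p∘f′-factors (R.≈ᴹ-trans (p∘ι (b i)) (R.≈ᴹ-sym (L.lifts i))))
                       (R.≈ᴹ-trans (p.cong e) (S′.p-lincomb c))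

          z-independentᶠ : CVq.Independent z
          z-independentᶠ c h i = φ.injective (K.trans (z-independent (φ.embed ∘ c) h i) (K.sym φ.0#-homo))

          -- For a in F the vector w₀ + a w₁ is sent to z₀ + σ(a) z₁, which must be proportional to an
          -- F-combination of the z's.
          preserves : ∀ {k} → n ≡ ℕ.suc (ℕ.suc k) → ∀ a → ∃[ a′ ] A.σ (φ.embed a) K.≈ φ.embed a′
          preserves ≡.refl a =
            let t , x″ , x″∈W′ , f′x≈ = f′-W (c , ≈ᴹ-refl) (nonzero c zero F.1≉0)
                d , x″≈ = FF.independent⇒spanning Vq {S = S′.W} dimW′ z∈W′ z-independentᶠ x″∈W′
                σc≈td = independent⇒unique {b = z} z-independent {λ i → A.σ (φ.embed (c i))} {λ i → t K.* φ.embed (d i)}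
                  (≈ᴹ-trans (≈ᴹ-sym (f′.lincomb-homo (φ.embed ∘ c) L.w)) (≈ᴹ-trans f′x≈
                  (≈ᴹ-trans (*ₗ-congˡ x″≈) (≈ᴹ-sym (lincomb-* t (φ.embed ∘ d) z)))))
                -- The coefficient of z₀ reads t d₀ = 1, so t is the inverse e of d₀ and lies in F;
                -- the coefficient of z₁ then gives σ(a) = e d₁.
                td₀≈1 = K.trans (K.sym (σc≈td zero)) (K.trans (A.σ-cong φ.1#-homo) A.σ-1)
                d₀≉0 = λ d₀≈0 → K.1≉0 (K.trans (K.sym td₀≈1)
                  (K.trans (K.*-congˡ (K.trans (φ.⟦⟧-cong d₀≈0) φ.0#-homo)) (K.zeroʳ t)))
                e , d₀e≈1 = F.inverse (d zero) d₀≉0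
                t≈e = K.trans (K.sym (K.*-identityʳ t)) (K.trans (K.*-congˡ (K.trans (K.sym φ.1#-homo)
                  (K.trans (φ.⟦⟧-cong (F.sym d₀e≈1)) (φ.*-homo _ _)))) (K.trans (K.sym (K.*-assoc t _ _))
                  (K.trans (K.*-congʳ td₀≈1) (K.*-identityˡ _))))
            in e F.* d (suc zero) , K.trans (σc≈td (suc zero))
                 (K.trans (K.*-congʳ t≈e) (K.sym (φ.*-homo _ _)))
            where
            c : Fin n → F.Carrier
            c = F.1# ∷ a ∷ (λ _ → F.0#)

-- Ranks 0 and 1, and the assembly of the theorem

module _ {F K : Field} (φ : FieldExtension F K) {q N : ℕ} (orderF : HasOrder F q) (orderK : HasOrder K N)
         (R : VectorSpace K) {r : ℕ} (dimR : HasDim (whole R) r) where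

  private
    module F = Field F
    module K = Field K
    module φ = FieldExtension φ
    module FK = FiniteField K orderK
    module PR = Points FK._≈?_ R
  open VectorSpace R
  open Combinations R
  open Reduction φ orderF orderK R
  private module Rq = Combinations Rq

  -- For n ≤ 1 a collineation matching the subgeometries gives no control over σ on F; a scaling of R
  -- then carries b to b′.
  scaling-transportable : ∀ {n} {b b′ : Fin n → Carrierᴹ} {a} → ¬ a K.≈ K.0# →
                          (∀ i → Rq.InSpan b′ (a *ₗ b i)) → Transportable φ orderF orderK R dimR b b′
  scaling-transportable {a = a} a≉0 carries = id , (a *ₗ_) , record
    { σ-cong      = id
    ; g-cong      = *ₗ-congˡ
    ; σ-+         = λ _ _ → K.refl
    ; σ-*         = λ _ _ → K.refl
    ; σ-1         = K.refl
    ; σ-injective = λ _ _ → id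
    ; g-+         = *ₗ-distribˡ a
    ; g-*         = λ c v → ≈ᴹ-trans (≈ᴹ-sym (*ₗ-assoc a c v)) (≈ᴹ-trans (*ₗ-congʳ (K.*-comm a c)) (*ₗ-assoc c a v))
    ; g-injective = λ _ _ → scale-injective a≉0
    ; preserves   = λ a → a , K.refl
    ; carries     = carries
    }

  transportable-0 : {b b′ : Fin 0 → Carrierᴹ} → Transportable φ orderF orderK R dimR b b′
  transportable-0 = scaling-transportable K.1≉0 λ ()

  -- The single vector of b spans R over K, so that of b′ is a multiple a of it, and a is nonzero
  -- because b′ is independent.
  transportable-1 : {b b′ : Fin 1 → Carrierᴹ} → Rq.Independent b′ → (∀ v → InSpan b v) →
                    Transportable φ orderF orderK R dimR b b′
  transportable-1 {b} {b′} indep spans = scaling-transportable a≉0 λ { zero →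
      (λ _ → F.1#) , ≈ᴹ-trans (≈ᴹ-sym b′≈ab) (≈ᴹ-sym (≈ᴹ-trans (PR.lincomb₁ (λ _ → φ.embed F.1#) b′)
        (≈ᴹ-trans (*ₗ-congʳ φ.1#-homo) (*ₗ-identityˡ _)))) }
    where
    a = proj₁ (spans (b′ zero)) zero
    b′≈ab : b′ zero ≈ᴹ a *ₗ b zero
    b′≈ab = ≈ᴹ-trans (proj₂ (spans (b′ zero))) (PR.lincomb₁ (proj₁ (spans (b′ zero))) b)
    a≉0 : ¬ a K.≈ K.0#
    a≉0 a≈0 = F.1≉0 (indep (λ _ → F.1#) (≈ᴹ-trans (PR.lincomb₁ (λ _ → φ.embed F.1#) b′)
      (≈ᴹ-trans (*ₗ-congˡ (≈ᴹ-trans b′≈ab (≈ᴹ-trans (*ₗ-congʳ a≈0) (*ₗ-zeroˡ _)))) (*ₗ-zeroʳ _))) zero)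

  -- Each point of L contains a nonzero vector of the F-span of b and is spanned by it over K; hence
  -- the K-span of b contains all points of L, and these span R.
  represents⇒spanning : ∀ {n} {L : PointSet R} {b : Fin n → Carrierᴹ} → L ⊆ 𝓑 φ R (Rq.linearSpan b) →
                        vectors ⟨ L ⟩ ≐ vectors (whole R) → ∀ v → InSpan b v
  represents⇒spanning {b = b} L⊆ (_ , ⊆⟨L⟩) v = Span⊆ (linearSpan b)
    (λ (P , P∈L , v∈P) → let u , u∈P , (c , u≈) , u≉0 = ∈𝓑⇒ (Rq.linearSpan b) {P} (L⊆ {P} P∈L) in
      PR.⊆-by-generator P (linearSpan b) u∈P u≉0 (φ.embed ∘ c , u≈) v∈P)
    (⊆⟨L⟩ tt)

  represents⇒≐ : ∀ {n} {L : PointSet R} {S : Subspace Rq 0ℓ} (dimS : HasDim S n) → L ≐ 𝓑 φ R S →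
                 ∀ {b} → Represents φ orderF orderK R dimR (HasDim.basis dimS) b →
                 L ≐ 𝓑 φ R (Rq.linearSpan b)
  represents⇒≐ {L = L} {S} dimS (L⊆S , S⊆L) {b} (_ , b≤s , s≤b) =
      (λ {P} P∈L → let u , u∈P , u∈S , u≉0 = ∈𝓑⇒ S {P} (L⊆S {P} P∈L) in
         Dominated⇒𝓑⊆ φ orderF orderK R dimR {Rq.linearSpan s} {B} s≤b {P}
           (∈𝓑⇐ (Rq.linearSpan s) {P} (u , u∈P , HasDim.spanning dimS u∈S , u≉0)))
    , (λ {P} P∈B → let u , u∈P , (c , u≈) , u≉0 = ∈𝓑⇒ (Rq.linearSpan s) {P}
                         (Dominated⇒𝓑⊆ φ orderF orderK R dimR {B} {Rq.linearSpan s} b≤s {P} P∈B) in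
         S⊆L {P} (∈𝓑⇐ S {P} (u , u∈P , Subspace.resp S (≈ᴹ-sym u≈) (Rq.lincomb∈ S c (HasDim.basis∈ dimS)) , u≉0)))
    where
    s = HasDim.basis dimS
    B = Rq.linearSpan b

theorem5p5 : (q t r n : ℕ) → IsPrimePower q →
    (F K : Field) → HasOrder F q → HasOrder K (q ^ t) →
    (φ : FieldExtension F K) →
    (R : VectorSpace K) → HasProjDim (whole R) (+ r - 1ℤ) →
    (L : PointSet R) → IsLinearSet φ R L n →
    vectors ⟨ L ⟩ ≐ vectors (whole R) →
    ¬ ConditionA φ R L n →
    r ≤ n ×
    ((V : VectorSpace K) → HasProjDim (whole V) (+ n - 1ℤ) →
    (ι : Embedding R V) →
    let Λ = Embedding.range ι in
    Σ (Subspace V 0ℓ) λ Γ → Σ (PointSet V) λ Σ₁ → Σ (PointSet V) λ Σ₂ →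
    HasProjDim Γ (+ n - 1ℤ - + r) ×
    Disjoint (points Γ) (points Λ) ×
    IsCanonicalSubgeometry φ V Σ₁ × Disjoint Σ₁ (points Γ) ×
    IsCanonicalSubgeometry φ V Σ₂ × Disjoint Σ₂ (points Γ) ×
    Embedding.imagePoints ι L ≐ projection Γ Λ Σ₁ ×
    Embedding.imagePoints ι L ≐ projection Γ Λ Σ₂ ×
    ¬ (∃[ β ] IsCollineation V β × Σ₁ ^^ β ≐ Σ₂ × points Γ ^^ β ≐ points Γ))
theorem5p5 q t r n _ F K orderF orderK φ R pdR L (S , pdS , L≐S) ⟨L⟩≐R ¬A =
    -- The n vectors of b₁ span R over K, whose dimension is r.
    FiniteField.independent⇒≤ K orderK R (HasDim.independent dimR) (λ c → spans₁ _)
  , λ V pdV ι → let open ForSpace V (projDim⇒dim {S = whole V} pdV) ι in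
      Γ , S₁.subgeometry , S₂.subgeometry
    , (m , dimΓ , codimension)
    , Γ-disjoint-Λ
    , S₁.isCanonical , S₁.disjoint-Γ
    , S₂.isCanonical , S₂.disjoint-Γ
    , S₁.projects {L} (represents⇒≐ φ orderF orderK R dimR dimS L≐S rep₁)
    , S₂.projects {L} (represents⇒≐ φ orderF orderK R dimR dimS L≐S rep₂)
    , λ (β , isColl , S₁^β≐S₂ , Γ^β≐Γ) → ¬transportable
        (compare isColl Γ^β≐Γ S₁^β≐S₂ n ≡.refl)
  where
  dimR : HasDim (whole R) r
  dimR = projDim⇒dim {S = whole R} pdR
  dimS : HasDim S n
  dimS = projDim⇒dim {S = S} pdS
  pair = untransportablePair φ orderF orderK R dimR {L = L} dimS L≐S ¬A
  b₁ = proj₁ pair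
  b₂ = proj₁ (proj₂ pair)
  rep₁ = proj₁ (proj₂ (proj₂ pair))
  rep₂ = proj₁ (proj₂ (proj₂ (proj₂ pair)))
  ¬transportable = proj₂ (proj₂ (proj₂ (proj₂ pair)))
  spans₁ : ∀ v → Combinations.InSpan R b₁ v
  spans₁ = represents⇒spanning φ orderF orderK R dimR {L = L}
             (proj₁ (represents⇒≐ φ orderF orderK R dimR {L = L} dimS L≐S rep₁)) ⟨L⟩≐R
  spans₂ : ∀ v → Combinations.InSpan R b₂ v
  spans₂ = represents⇒spanning φ orderF orderK R dimR {L = L}
             (proj₁ (represents⇒≐ φ orderF orderK R dimR {L = L} dimS L≐S rep₂)) ⟨L⟩≐R

  module ForSpace (V : VectorSpace K) (dimV : HasDim (whole V) n) (ι : Embedding R V) where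
    open Construction φ orderF orderK R dimR V dimV ι public
    lifted₁ : LiftedBasis b₁
    lifted₁ = liftBasis b₁ spans₁
    lifted₂ : LiftedBasis b₂
    lifted₂ = liftBasis b₂ spans₂
    module S₁ = Subgeometry (proj₁ rep₁) lifted₁
    module S₂ = Subgeometry (proj₁ rep₂) lifted₂

    codimension : + n - 1ℤ - + r ≡ + m - 1ℤ
    codimension = ≡.trans (≡.cong (λ k → + k - 1ℤ - + r) (≡.sym m+r≡n))
      (≡.trans (≡.cong (λ k → k - 1ℤ - + r) (ℤ.pos-+ m r)) (rearrange (+ m) (+ r)))
      where
      rearrange : ∀ x y → x ℤ.+ y - 1ℤ - y ≡ x - 1ℤ
      rearrange = solve-∀

    compare : ∀ {β} → IsCollineation V β → points Γ ^^ β ≐ points Γ →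
              S₁.subgeometry ^^ β ≐ S₂.subgeometry → ∀ k → n ≡ k →
              Transportable φ orderF orderK R dimR b₁ b₂
    compare isColl Γ^β≐Γ S₁^β≐S₂ 0 ≡.refl = transportable-0 φ orderF orderK R dimR
    compare isColl Γ^β≐Γ S₁^β≐S₂ 1 ≡.refl = transportable-1 φ orderF orderK R dimR (proj₁ rep₂) spans₁
    compare isColl Γ^β≐Γ S₁^β≐S₂ (ℕ.suc (ℕ.suc k)) e =
      Comparison.transportable φ orderF orderK R dimR V dimV ι isColl Γ^β≐Γ
        (proj₁ rep₁) (proj₁ rep₂) lifted₁ lifted₂ S₁^β≐S₂ e
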